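{- For every $n\ge 2$, each of the six sets $BEGJ^n$, $BEGY^n$, $BEJV^n$, $BEVY^n$, $BJTV^n$, $EJRV^n$ has cardinality $$\frac{n\,T_{2n-1}}{2^{\,n-2}},$$ where $T_{2k+1}$ denotes the tangent numbers, defined by $\tan u=\sum_{k\ge0}T_{2k+1}\frac{u^{2k+1}}{(2k+1)!}$. Here, for a word $W$ of piece-letters, $W^n$ is the set of standard puzzles of shape $2\times n$ each of whose pieces reduces to one of the standard pieces named by the letters of $W$, and the standard pieces are (giving top-left, top-right / bottom-left, bottom-right): $B$: $3,4\,/\,1,2$; $E$: $3,2\,/\,1,4$; $G$: $4,3\,/\,2,1$; $J$: $4,1\,/\,2,3$; $R$: $1,4\,/\,3,2$; $T$: $1,2\,/\,3,4$; $V$: $2,3\,/\,4,1$; $Y$: $2,1\,/\,4,3$.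
   Context: A piece is a unit square with four labels on its corners; a standard piece has labels exactly $1,2,3,4$. The reduction of a piece with four distinct labels is the standard piece obtained by replacing the labels by $1,2,3,4$ preserving their relative order. A standard puzzle of shape $2\times n$ is a $2\times n$ array $\begin{bmatrix}a_1&\cdots&a_n\\ b_1&\cdots&b_n\end{bmatrix}$ whose $2n$ entries are exactly $1,\dots,2n$; for $1\le i\le n-1$ its $i$-th piece is the square with top-left label $a_i$, top-right $a_{i+1}$, bottom-left $b_i$, bottom-right $b_{i+1}$. -}

module Defs where

open import Data.Nat as ℕ using (ℕ; zero; suc; _∸_; _^_; _!; _<?_)
open import Data.Nat.Properties using (_!≢0)
open import Data.Integer as ℤ using (ℤ; +_)
open import Data.Rational using (ℚ; _/_; _+_; _-_; _*_; -_; 0ℚ)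
open import Data.List using (List; []; _∷_; length; map; upTo)
open import Data.List.Relation.Unary.All using (All)
open import Data.List.Relation.Unary.Any using (Any)
open import Data.List.Relation.Unary.Unique.Propositional using (Unique)
open import Data.List.Membership.Propositional using (_∈_)
open import Data.List.Relation.Binary.Permutation.Propositional using (_↭_)
open import Data.Vec as Vec using (Vec; toList; count)
open import Data.Product using (Σ; _×_; _,_)
open import Function.Bundles using (_⇔_)
open import Relation.Binary.PropositionalEquality using (_≡_)

ℕ→ℚ : ℕ → ℚ
ℕ→ℚ n = (+ n) / 1

sign : ℕ → ℚ
sign zero = (+ 1) / 1
sign (suc k) = - sign k

half : ℕ → Σ ℕ λ _ → ℕ
half zero = 0 , 0
half (suc zero) = 0 , 1
half (suc (suc j)) with half j
... | q , r = suc q , r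

sinCoeff : ℕ → ℚ
sinCoeff m with half m
... | q , 1 = sign q * ((+ 1) / (m !)) {{m !≢0}}
... | _ , _ = 0ℚ

cosCoeff : ℕ → ℚ
cosCoeff m with half m
... | q , 0 = sign q * ((+ 1) / (m !)) {{m !≢0}}
... | _ , _ = 0ℚ

private
  conv : ℕ → List ℚ → ℚ
  conv i [] = 0ℚ
  conv i (x ∷ xs) = x * cosCoeff (suc i) + conv (suc i) xs

-- tanCoeffs m = [t_m , t_{m-1} , … , t_0] where tan u = Σ t_k u^k,
-- determined by (Σ t_k u^k) · cos u = sin u  (cos has constant term 1):
-- t_m = s_m - Σ_{k<m} t_k c_{m-k}.
tanCoeffs : ℕ → List ℚ
tanCoeffs zero = sinCoeff 0 ∷ []
tanCoeffs (suc m) = (sinCoeff (suc m) - conv 0 prev) ∷ prev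
  where prev = tanCoeffs m

tanCoeff : ℕ → ℚ
tanCoeff m with tanCoeffs m
... | t ∷ _ = t
... | [] = 0ℚ

T : ℕ → ℚ
T m = ℕ→ℚ (m !) * tanCoeff m

-- a piece is given by its labels (top-left, top-right, bottom-left, bottom-right)
Piece : Set
Piece = Vec ℕ 4

reduce : Piece → Piece
reduce p = Vec.map (λ x → suc (count (_<? x) p)) p

data Letter : Set where
  B E G J R T' V Y : Letter

std : Letter → Piece
std B  = 3 Vec.∷ 4 Vec.∷ 1 Vec.∷ 2 Vec.∷ Vec.[]
std E  = 3 Vec.∷ 2 Vec.∷ 1 Vec.∷ 4 Vec.∷ Vec.[]
std G  = 4 Vec.∷ 3 Vec.∷ 2 Vec.∷ 1 Vec.∷ Vec.[]
std J  = 4 Vec.∷ 1 Vec.∷ 2 Vec.∷ 3 Vec.∷ Vec.[]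
std R  = 1 Vec.∷ 4 Vec.∷ 3 Vec.∷ 2 Vec.∷ Vec.[]
std T' = 1 Vec.∷ 2 Vec.∷ 3 Vec.∷ 4 Vec.∷ Vec.[]
std V  = 2 Vec.∷ 3 Vec.∷ 4 Vec.∷ 1 Vec.∷ Vec.[]
std Y  = 2 Vec.∷ 1 Vec.∷ 4 Vec.∷ 3 Vec.∷ Vec.[]

-- a 2×n array: (top row a_1…a_n , bottom row b_1…b_n)
Array : ℕ → Set
Array n = Vec ℕ n × Vec ℕ n

pieces : ∀ {n} → Vec ℕ n → Vec ℕ n → List Piece
pieces (a Vec.∷ a' Vec.∷ as) (b Vec.∷ b' Vec.∷ bs) =
  (a Vec.∷ a' Vec.∷ b Vec.∷ b' Vec.∷ Vec.[]) ∷ pieces (a' Vec.∷ as) (b' Vec.∷ bs)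
pieces _ _ = []

IsStandardPuzzle : ∀ {n} → Array n → Set
IsStandardPuzzle {n} (as , bs) =
  (toList as Data.List.++ toList bs) ↭ map suc (upTo (2 ℕ.* n))

InW : List Letter → (n : ℕ) → Array n → Set
InW W n p@(as , bs) =
  IsStandardPuzzle p × All (λ pc → Any (λ l → reduce pc ≡ std l) W) (pieces as bs)

HasCard : {A : Set} → (A → Set) → ℕ → Set
HasCard {A} P k = Σ (List A) λ L → Unique L × (∀ x → (x ∈ L) ⇔ P x) × length L ≡ k

BEGJ BEGY BEJV BEVY BJTV EJRV : List Letter
BEGJ = B ∷ E ∷ G ∷ J ∷ []
BEGY = B ∷ E ∷ G ∷ Y ∷ []
BEJV = B ∷ E ∷ J ∷ V ∷ []
BEVY = B ∷ E ∷ V ∷ Y ∷ []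
BJTV = B ∷ J ∷ T' ∷ V ∷ []
EJRV = E ∷ J ∷ R ∷ V ∷ []

sixWords : List (List Letter)
sixWords = BEGJ ∷ BEGY ∷ BEJV ∷ BEVY ∷ BJTV ∷ EJRV ∷ []

{-# OPTIONS --safe #-}
module Submission where

-- Read a column as the chord joining its two labels on the line 1, …, 2n. Each standard piece says
-- that two consecutive chords cross, which of them is lower, and how both columns are oriented. In
-- each of the six words the orientation of the right column and the relative position of the chords
-- determine the orientation of the left column, so Wⁿ has twice as many elements as there are
-- sequences of n chords on 2n points in which consecutive chords cross.
--
-- Crossing is invariant under rotating the points around a circle, so the number of sequences that
-- start with a given chord depends only on the numbers d and e of points on its two sides. Its
-- second difference in d (for fixed d + e) is −2 times the number for two points fewer. After
-- rescaling −2 to −4, the exponential generating function of these numbers is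
-- cos 2u + sin 2u · S (u + v), where S collects the sums over d. Summing over d gives
-- S = sin u cos u + sin² u · S, and the tangent series is the only solution of this equation.

open import Defs
open import Algebra.Structures using (IsCommutativeMonoid)
open import Data.Bool using (Bool; true; false; if_then_else_)
open import Data.Empty using (⊥-elim)
import Data.Integer as ℤ
import Data.Integer.Properties as ℤₚ
open import Data.List using (List; []; _∷_; _++_; _ʳ++_; length; map; upTo; reverse)
import Data.List.Properties as Listₚ
open import Data.List.Membership.Propositional using (_∈_; find; lose)
open import Data.List.Membership.Propositional.Properties
  using (∈-++⁻; ∈-++⁺ˡ; ∈-++⁺ʳ; ∈-map⁺; ∈-map⁻; ∈-∃++; ∈-insert)
open import Data.List.Relation.Binary.Permutation.Propositional as Perm
  using (_↭_; ↭-refl; ↭-sym; ↭-trans; ↭-reflexive; prep)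
open import Data.List.Relation.Binary.Permutation.Propositional.Properties
  using (shift; shifts; drop-∷; ↭-length; ∈-resp-↭; ↭-reverse)
open import Data.List.Relation.Unary.All as All using (All; []; _∷_)
import Data.List.Relation.Unary.All.Properties as Allₚ
open import Data.List.Relation.Unary.AllPairs as AllPairs using (AllPairs; []; _∷_)
import Data.List.Relation.Unary.AllPairs.Properties as AllPairsₚ
open import Data.List.Relation.Unary.Any using (Any; here; there)
open import Data.List.Relation.Unary.Linked using (Linked; []; [-]; _∷_)
open import Data.List.Relation.Unary.Unique.Propositional using (Unique)
import Data.List.Relation.Unary.Unique.Propositional.Properties as Uniqueₚ
open import Data.Nat as ℕ using (ℕ; zero; suc; _<_; _≤_; _<ᵇ_; _<?_; _!; z≤n; s≤s)
open import Data.Nat.Induction using (<-rec)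
import Data.Nat.Properties as ℕₚ
open import Data.Product using (Σ; ∃; _×_; _,_; proj₁; proj₂)
import Data.Rational.Properties as ℚₚ
import Data.Rational.Unnormalised as ℚᵘ
import Data.Rational.Unnormalised.Properties as ℚᵘₚ
open import Data.Sum using (_⊎_; inj₁; inj₂; [_,_]′)
open import Data.Vec using (Vec; []; _∷_; toList; zip; count)
open import Function using (_∘_; _∘′_; flip; id)
open import Function.Bundles using (mk⇔; Equivalence)
open import Relation.Binary.Definitions using (tri<; tri≈; tri>)
open import Relation.Binary.PropositionalEquality hiding (J)
open import Relation.Nullary using (¬_)
open ≡-Reasoning

-- Sums over pairs of indices with a fixed total.

-- splitSum f n = Σ_{i + 1 + j = n} f i j
module SplitSum {A : Set} {_∙_ : A → A → A} {ε : A}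
                (isCM : IsCommutativeMonoid _≡_ _∙_ ε) where
  open IsCommutativeMonoid isCM using (assoc; comm; identityˡ)

  private
    interchange : ∀ a b c d → (a ∙ b) ∙ (c ∙ d) ≡ (a ∙ c) ∙ (b ∙ d)
    interchange a b c d = begin
      (a ∙ b) ∙ (c ∙ d)  ≡⟨ assoc a b (c ∙ d) ⟩
      a ∙ (b ∙ (c ∙ d))  ≡⟨ cong (a ∙_) (assoc b c d) ⟨
      a ∙ ((b ∙ c) ∙ d)  ≡⟨ cong (λ x → a ∙ (x ∙ d)) (comm b c) ⟩
      a ∙ ((c ∙ b) ∙ d)  ≡⟨ cong (a ∙_) (assoc c b d) ⟩
      a ∙ (c ∙ (b ∙ d))  ≡⟨ assoc a c (b ∙ d) ⟨
      (a ∙ c) ∙ (b ∙ d)  ∎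

  splitSum : (ℕ → ℕ → A) → ℕ → A
  splitSum f zero    = ε
  splitSum f (suc n) = f 0 n ∙ splitSum (f ∘ suc) n

  splitSum-cong : ∀ {f g} n → (∀ i j → suc (i ℕ.+ j) ≡ n → f i j ≡ g i j) →
                  splitSum f n ≡ splitSum g n
  splitSum-cong zero    f≗g = refl
  splitSum-cong (suc n) f≗g = cong₂ _∙_ (f≗g 0 n refl)
    (splitSum-cong n (λ i j i+j → f≗g (suc i) j (cong suc i+j)))

  splitSum-ε : ∀ n → splitSum (λ _ _ → ε) n ≡ ε
  splitSum-ε zero    = refl
  splitSum-ε (suc n) = trans (identityˡ _) (splitSum-ε n)

  splitSum-∙ : ∀ f g n → splitSum (λ i j → f i j ∙ g i j) n ≡ splitSum f n ∙ splitSum g n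
  splitSum-∙ f g zero    = sym (identityˡ ε)
  splitSum-∙ f g (suc n) =
    trans (cong ((f 0 n ∙ g 0 n) ∙_) (splitSum-∙ (f ∘ suc) (g ∘ suc) n)) (interchange (f 0 n) (g 0 n) _ _)

  splitSum-snoc : ∀ f n → splitSum f (suc n) ≡ splitSum (λ i j → f i (suc j)) n ∙ f n 0
  splitSum-snoc f zero    = comm _ _
  splitSum-snoc f (suc n) =
    trans (cong (f 0 (suc n) ∙_) (splitSum-snoc (f ∘ suc) n)) (sym (assoc _ _ _))

  splitSum-flip : ∀ f n → splitSum (flip f) n ≡ splitSum f n
  splitSum-flip f zero    = refl
  splitSum-flip f (suc n) = begin
    f n 0 ∙ splitSum (λ i j → f j (suc i)) n  ≡⟨ cong (f n 0 ∙_) (splitSum-flip (λ i j → f i (suc j)) n) ⟩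
    f n 0 ∙ splitSum (λ i j → f i (suc j)) n  ≡⟨ comm _ _ ⟩
    splitSum (λ i j → f i (suc j)) n ∙ f n 0  ≡⟨ splitSum-snoc f n ⟨
    splitSum f (suc n)                        ∎

  splitSum-++ : ∀ f a b → splitSum f (a ℕ.+ b) ≡
                splitSum (λ i j → f i (j ℕ.+ b)) a ∙ splitSum (λ i j → f (a ℕ.+ i) j) b
  splitSum-++ f zero    b = sym (identityˡ _)
  splitSum-++ f (suc a) b =
    trans (cong (f 0 (a ℕ.+ b) ∙_) (splitSum-++ (f ∘ suc) a b)) (sym (assoc _ _ _))

  splitSum-swap : ∀ (f : ℕ → ℕ → ℕ → ℕ → A) m n →
                  splitSum (λ i i′ → splitSum (f i i′) n) m ≡
                  splitSum (λ j j′ → splitSum (λ i i′ → f i i′ j j′) m) n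
  splitSum-swap f zero    n = sym (splitSum-ε n)
  splitSum-swap f (suc m) n = trans (cong (splitSum (f 0 m) n ∙_) (splitSum-swap (f ∘ suc) m n))
                                     (sym (splitSum-∙ (f 0 m) (λ j j′ → splitSum (λ i i′ → f (suc i) i′ j j′) m) n))

  splitSum-hom : ∀ (φ : A → A) → φ ε ≡ ε → (∀ x y → φ (x ∙ y) ≡ φ x ∙ φ y) →
                 ∀ f n → splitSum (λ i j → φ (f i j)) n ≡ φ (splitSum f n)
  splitSum-hom φ φ-ε φ-∙ f zero    = sym φ-ε
  splitSum-hom φ φ-ε φ-∙ f (suc n) =
    trans (cong (φ (f 0 n) ∙_) (splitSum-hom φ φ-ε φ-∙ (f ∘ suc) n)) (sym (φ-∙ _ _))

-- Exponential generating functions and the tangent series.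

module Tangent where
  open import Data.Rational using (ℚ; _/_; _+_; _-_; _*_; -_; 0ℚ; 1ℚ; toℚᵘ; fromℚᵘ)
  open import Data.Rational.Solver using (module +-*-Solver)
  open SplitSum ℕₚ.+-0-isCommutativeMonoid
  module ℚΣ = SplitSum ℚₚ.+-0-isCommutativeMonoid

  splitSum-*ˡ : ∀ c f n → ℚΣ.splitSum (λ i j → c * f i j) n ≡ c * ℚΣ.splitSum f n
  splitSum-*ˡ c f n = ℚΣ.splitSum-hom (c *_) (ℚₚ.*-zeroʳ c) (ℚₚ.*-distribˡ-+ c) f n

  ℕ→ℚ-+ : ∀ m n → ℕ→ℚ (m ℕ.+ n) ≡ ℕ→ℚ m + ℕ→ℚ n
  ℕ→ℚ-+ m n = ℚₚ.toℚᵘ-injective (begin≃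
    toℚᵘ (fromℚᵘ (ℚᵘ.mkℚᵘ (ℤ.+ (m ℕ.+ n)) 0))
      ≈⟨ ℚₚ.toℚᵘ-fromℚᵘ _ ⟩
    ℚᵘ.mkℚᵘ (ℤ.+ (m ℕ.+ n)) 0
      ≈⟨ ℚᵘ.*≡* (cong (ℤ._* ℤ.+ 1)
             (cong₂ ℤ._+_ (sym (ℤₚ.*-identityʳ (ℤ.+ m))) (sym (ℤₚ.*-identityʳ (ℤ.+ n))))) ⟩
    ℚᵘ.mkℚᵘ (ℤ.+ m) 0 ℚᵘ.+ ℚᵘ.mkℚᵘ (ℤ.+ n) 0
      ≈⟨ ℚᵘₚ.+-cong (ℚₚ.toℚᵘ-fromℚᵘ (ℚᵘ.mkℚᵘ (ℤ.+ m) 0)) (ℚₚ.toℚᵘ-fromℚᵘ (ℚᵘ.mkℚᵘ (ℤ.+ n) 0)) ⟨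
    toℚᵘ (ℕ→ℚ m) ℚᵘ.+ toℚᵘ (ℕ→ℚ n)
      ≈⟨ ℚₚ.toℚᵘ-homo-+ (ℕ→ℚ m) (ℕ→ℚ n) ⟨
    toℚᵘ (ℕ→ℚ m + ℕ→ℚ n) ∎≃)
    where open ℚᵘₚ.≃-Reasoning renaming (begin_ to begin≃_; _∎ to _∎≃)

  ℕ→ℚ-* : ∀ m n → ℕ→ℚ (m ℕ.* n) ≡ ℕ→ℚ m * ℕ→ℚ n
  ℕ→ℚ-* m n = ℚₚ.toℚᵘ-injective (begin≃
    toℚᵘ (fromℚᵘ (ℚᵘ.mkℚᵘ (ℤ.+ (m ℕ.* n)) 0))
      ≈⟨ ℚₚ.toℚᵘ-fromℚᵘ _ ⟩
    ℚᵘ.mkℚᵘ (ℤ.+ (m ℕ.* n)) 0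
      ≈⟨ ℚᵘ.*≡* (cong (ℤ._* ℤ.+ 1) (ℤₚ.pos-* m n)) ⟩
    ℚᵘ.mkℚᵘ (ℤ.+ m) 0 ℚᵘ.* ℚᵘ.mkℚᵘ (ℤ.+ n) 0
      ≈⟨ ℚᵘₚ.*-cong (ℚₚ.toℚᵘ-fromℚᵘ (ℚᵘ.mkℚᵘ (ℤ.+ m) 0)) (ℚₚ.toℚᵘ-fromℚᵘ (ℚᵘ.mkℚᵘ (ℤ.+ n) 0)) ⟨
    toℚᵘ (ℕ→ℚ m) ℚᵘ.* toℚᵘ (ℕ→ℚ n)
      ≈⟨ ℚₚ.toℚᵘ-homo-* (ℕ→ℚ m) (ℕ→ℚ n) ⟨
    toℚᵘ (ℕ→ℚ m * ℕ→ℚ n) ∎≃)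
    where open ℚᵘₚ.≃-Reasoning renaming (begin_ to begin≃_; _∎ to _∎≃)

  1/!-inverse : ∀ m → ℕ→ℚ (m !) * ((ℤ.+ 1) / (m !)) {{m ℕₚ.!≢0}} ≡ 1ℚ
  1/!-inverse m = lemma (m !) {{m ℕₚ.!≢0}}
    where
    -- Generalised from `m !` to any nonzero `n`, which can be matched as a successor.
    lemma : ∀ n .{{_ : ℕ.NonZero n}} → ℕ→ℚ n * ((ℤ.+ 1) / n) ≡ 1ℚ
    lemma n@(suc n-1) = ℚₚ.toℚᵘ-injective (begin≃
      toℚᵘ (ℕ→ℚ n * ((ℤ.+ 1) / n))
      ≈⟨ ℚₚ.toℚᵘ-homo-* (ℕ→ℚ n) ((ℤ.+ 1) / n) ⟩
      toℚᵘ (ℕ→ℚ n) ℚᵘ.* toℚᵘ ((ℤ.+ 1) / n)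
      ≈⟨ ℚᵘₚ.*-cong (ℚₚ.toℚᵘ-fromℚᵘ (ℚᵘ.mkℚᵘ (ℤ.+ n) 0)) (ℚₚ.toℚᵘ-fromℚᵘ (ℚᵘ.mkℚᵘ (ℤ.+ 1) n-1)) ⟩
      ℚᵘ.mkℚᵘ (ℤ.+ n) 0 ℚᵘ.* ℚᵘ.mkℚᵘ (ℤ.+ 1) n-1
        ≈⟨ ℚᵘ.*≡* (trans (ℤₚ.*-identityʳ _) (trans (ℤₚ.*-identityʳ _)
               (trans (cong ℤ.+_ (sym (ℕₚ.+-identityʳ n))) (sym (ℤₚ.*-identityˡ _))))) ⟩
      toℚᵘ 1ℚ ∎≃)
      where open ℚᵘₚ.≃-Reasoning renaming (begin_ to begin≃_; _∎ to _∎≃)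

  -- A sequence f stands for the exponential generating function Σ f n uⁿ / n!,
  -- so that f ∘ suc is its derivative and ⊛ is the product, defined by the Leibniz rule.
  infixl 7 _⊛_
  _⊛_ : (ℕ → ℚ) → (ℕ → ℚ) → ℕ → ℚ
  (f ⊛ g) zero    = f 0 * g 0
  (f ⊛ g) (suc n) = ((f ∘ suc) ⊛ g) n + (f ⊛ (g ∘ suc)) n

  δ : ℕ → ℚ
  δ zero    = 1ℚ
  δ (suc _) = 0ℚ

  open +-*-Solver

  -- A coefficient of a product involves no later coefficients of its factors.
  ⊛-congʳ-≤ : ∀ f {g h} n → (∀ k → k ≤ n → g k ≡ h k) → (f ⊛ g) n ≡ (f ⊛ h) n
  ⊛-congʳ-≤ f zero    g≗h = cong (f 0 *_) (g≗h 0 z≤n)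
  ⊛-congʳ-≤ f (suc n) g≗h = cong₂ _+_
    (⊛-congʳ-≤ (f ∘ suc) n (λ k k≤n → g≗h k (ℕₚ.m≤n⇒m≤1+n k≤n)))
    (⊛-congʳ-≤ f n (λ k k≤n → g≗h (suc k) (s≤s k≤n)))

  ⊛-congʳ : ∀ f {g h} → g ≗ h → f ⊛ g ≗ f ⊛ h
  ⊛-congʳ f g≗h n = ⊛-congʳ-≤ f n (λ k _ → g≗h k)

  -- If `f` has no constant term, the `n`-th coefficient of `f ⊛ g` does not involve `g n`. This
  -- makes the solution of S = a + f S unique.
  ⊛-congʳ-< : ∀ f {g h} n → f 0 ≡ 0ℚ → (∀ k → k < n → g k ≡ h k) → (f ⊛ g) n ≡ (f ⊛ h) n
  ⊛-congʳ-< f {g} {h} zero f0 g≗h = trans (cong (_* g 0) f0)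
    (trans (ℚₚ.*-zeroˡ (g 0)) (sym (trans (cong (_* h 0) f0) (ℚₚ.*-zeroˡ (h 0)))))
  ⊛-congʳ-< f (suc n) f0 g≗h = cong₂ _+_
    (⊛-congʳ-≤ (f ∘ suc) n (λ k k≤n → g≗h k (s≤s k≤n)))
    (⊛-congʳ-< f n f0 (λ k k<n → g≗h (suc k) (s≤s k<n)))

  ⊛-comm : ∀ f g → f ⊛ g ≗ g ⊛ f
  ⊛-comm f g zero    = ℚₚ.*-comm (f 0) (g 0)
  ⊛-comm f g (suc n) = trans (cong₂ _+_ (⊛-comm (f ∘ suc) g n) (⊛-comm f (g ∘ suc) n))
                                (ℚₚ.+-comm ((g ⊛ (f ∘ suc)) n) (((g ∘ suc) ⊛ f) n))

  ⊛-congˡ : ∀ {f g} h → f ≗ g → f ⊛ h ≗ g ⊛ h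
  ⊛-congˡ h f≗g n = trans (⊛-comm _ h n) (trans (⊛-congʳ h f≗g n) (⊛-comm h _ n))

  ⊛-distribˡ-+ : ∀ f g h → f ⊛ (λ k → g k + h k) ≗ λ n → (f ⊛ g) n + (f ⊛ h) n
  ⊛-distribˡ-+ f g h zero    = ℚₚ.*-distribˡ-+ (f 0) (g 0) (h 0)
  ⊛-distribˡ-+ f g h (suc n) = trans
    (cong₂ _+_ (⊛-distribˡ-+ (f ∘ suc) g h n) (⊛-distribˡ-+ f (g ∘ suc) (h ∘ suc) n))
    (solve 4 (λ a b c d → (a :+ b) :+ (c :+ d) := (a :+ c) :+ (b :+ d)) refl
      (((f ∘ suc) ⊛ g) n) (((f ∘ suc) ⊛ h) n) ((f ⊛ (g ∘ suc)) n) ((f ⊛ (h ∘ suc)) n))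

  ⊛-distribʳ-+ : ∀ f g h → (λ k → g k + h k) ⊛ f ≗ λ n → (g ⊛ f) n + (h ⊛ f) n
  ⊛-distribʳ-+ f g h n = trans (⊛-comm _ f n)
    (trans (⊛-distribˡ-+ f g h n) (cong₂ _+_ (⊛-comm f g n) (⊛-comm f h n)))

  ⊛-scaleˡ : ∀ c f g → (λ k → c * f k) ⊛ g ≗ λ n → c * (f ⊛ g) n
  ⊛-scaleˡ c f g zero    = ℚₚ.*-assoc c (f 0) (g 0)
  ⊛-scaleˡ c f g (suc n) = trans
    (cong₂ _+_ (⊛-scaleˡ c (f ∘ suc) g n) (⊛-scaleˡ c f (g ∘ suc) n))
    (sym (ℚₚ.*-distribˡ-+ c _ _))

  ⊛-zeroˡ : ∀ g → (λ _ → 0ℚ) ⊛ g ≗ λ _ → 0ℚ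
  ⊛-zeroˡ g zero    = ℚₚ.*-zeroˡ (g 0)
  ⊛-zeroˡ g (suc n) = cong₂ _+_ (⊛-zeroˡ g n) (⊛-zeroˡ (g ∘ suc) n)

  ⊛-identityˡ : ∀ g → δ ⊛ g ≗ g
  ⊛-identityˡ g zero    = ℚₚ.*-identityˡ (g 0)
  ⊛-identityˡ g (suc n) = trans (cong₂ _+_ (⊛-zeroˡ g n) (⊛-identityˡ (g ∘ suc) n)) (ℚₚ.+-identityˡ _)

  -- Differentiating either side gives the same three products, with the derivative on `f`, `g` or
  -- `h`.
  ⊛-assoc : ∀ f g h → (f ⊛ g) ⊛ h ≗ f ⊛ (g ⊛ h)
  ⊛-assoc f g h zero    = ℚₚ.*-assoc (f 0) (g 0) (h 0)
  ⊛-assoc f g h (suc n) = begin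
    ((λ k → (f′ ⊛ g) k + (f ⊛ g′) k) ⊛ h) n + ((f ⊛ g) ⊛ h′) n
      ≡⟨ cong₂ _+_ (⊛-distribʳ-+ h (f′ ⊛ g) (f ⊛ g′) n) refl ⟩
    ((f′ ⊛ g) ⊛ h) n + ((f ⊛ g′) ⊛ h) n + ((f ⊛ g) ⊛ h′) n
      ≡⟨ cong₂ _+_ (cong₂ _+_ (⊛-assoc f′ g h n) (⊛-assoc f g′ h n)) (⊛-assoc f g h′ n) ⟩
    (f′ ⊛ (g ⊛ h)) n + (f ⊛ (g′ ⊛ h)) n + (f ⊛ (g ⊛ h′)) n
      ≡⟨ ℚₚ.+-assoc ((f′ ⊛ (g ⊛ h)) n) _ _ ⟩
    (f′ ⊛ (g ⊛ h)) n + ((f ⊛ (g′ ⊛ h)) n + (f ⊛ (g ⊛ h′)) n)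
      ≡⟨ cong ((f′ ⊛ (g ⊛ h)) n +_) (⊛-distribˡ-+ f (g′ ⊛ h) (g ⊛ h′) n) ⟨
    (f′ ⊛ (g ⊛ h)) n + (f ⊛ (λ k → (g′ ⊛ h) k + (g ⊛ h′) k)) n ∎
    where
    f′ = f ∘ suc
    g′ = g ∘ suc
    h′ = h ∘ suc

  -- Converts ordinary Taylor coefficients, in which `tanCoeff` is defined, to exponential ones.
  egf : (ℕ → ℚ) → ℕ → ℚ
  egf c k = ℕ→ℚ (k !) * c k

  egf-suc : ∀ c k → egf c (suc k) ≡ egf (λ j → ℕ→ℚ (suc j) * c (suc j)) k
  egf-suc c k = begin
    ℕ→ℚ (suc k ℕ.* k !) * c (suc k)               ≡⟨ cong (_* c (suc k)) (ℕ→ℚ-* (suc k) (k !)) ⟩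
    (ℕ→ℚ (suc k) * ℕ→ℚ (k !)) * c (suc k)
      ≡⟨ solve 3 (λ a b c → (a :* b) :* c := b :* (a :* c)) refl (ℕ→ℚ (suc k)) (ℕ→ℚ (k !)) (c (suc k)) ⟩
    ℕ→ℚ (k !) * (ℕ→ℚ (suc k) * c (suc k))         ∎

  -- The Leibniz product is the Cauchy product: differentiating the left or the right factor weights
  -- the term at `i`, `j` by `i` or by `j`, and these weights add up to `suc n`, the new factor of
  -- the factorial.
  egf-⊛ : ∀ a b n → (egf a ⊛ egf b) n ≡ ℕ→ℚ (n !) * ℚΣ.splitSum (λ i j → a i * b j) (suc n)
  egf-⊛ a b zero = solve 2 (λ a b → (con 1ℚ :* a) :* (con 1ℚ :* b) := con 1ℚ :* (a :* b :+ con 0ℚ)) refl (a 0) (b 0)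
  egf-⊛ a b (suc n) = begin
    ((egf a ∘ suc) ⊛ egf b) n + (egf a ⊛ (egf b ∘ suc)) n
      ≡⟨ cong₂ _+_ (⊛-congˡ (egf b) (egf-suc a) n) (⊛-congʳ (egf a) (egf-suc b) n) ⟩
    (egf a′ ⊛ egf b) n + (egf a ⊛ egf b′) n
      ≡⟨ cong₂ _+_ (egf-⊛ a′ b n) (egf-⊛ a b′ n) ⟩
    n! * ℚΣ.splitSum (λ i j → a′ i * b j) (suc n) + n! * ℚΣ.splitSum (λ i j → a i * b′ j) (suc n)
      ≡⟨ ℚₚ.*-distribˡ-+ n! (ℚΣ.splitSum (λ i j → a′ i * b j) (suc n)) (ℚΣ.splitSum (λ i j → a i * b′ j) (suc n)) ⟨
    n! * (ℚΣ.splitSum (λ i j → a′ i * b j) (suc n) + ℚΣ.splitSum (λ i j → a i * b′ j) (suc n))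
      ≡⟨ cong (n! *_) (cong₂ _+_ first second) ⟩
    n! * (ℚΣ.splitSum (λ i j → ℕ→ℚ i * (a i * b j)) (2 ℕ.+ n) + ℚΣ.splitSum (λ i j → ℕ→ℚ j * (a i * b j)) (2 ℕ.+ n))
      ≡⟨ cong (n! *_) (ℚΣ.splitSum-∙ (λ i j → ℕ→ℚ i * (a i * b j)) (λ i j → ℕ→ℚ j * (a i * b j)) (2 ℕ.+ n)) ⟨
    n! * ℚΣ.splitSum (λ i j → ℕ→ℚ i * (a i * b j) + ℕ→ℚ j * (a i * b j)) (2 ℕ.+ n)
      ≡⟨ cong (n! *_) (ℚΣ.splitSum-cong (2 ℕ.+ n) collect) ⟩
    n! * ℚΣ.splitSum (λ i j → ℕ→ℚ (suc n) * (a i * b j)) (2 ℕ.+ n)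
      ≡⟨ cong (n! *_) (splitSum-*ˡ (ℕ→ℚ (suc n)) (λ i j → a i * b j) (2 ℕ.+ n)) ⟩
    n! * (ℕ→ℚ (suc n) * total)
      ≡⟨ solve 3 (λ x y z → x :* (y :* z) := (y :* x) :* z) refl n! (ℕ→ℚ (suc n)) total ⟩
    ℕ→ℚ (suc n) * n! * total
      ≡⟨ cong (_* total) (ℕ→ℚ-* (suc n) (n !)) ⟨
    ℕ→ℚ (suc n !) * total ∎
    where
    n! = ℕ→ℚ (n !)
    total = ℚΣ.splitSum (λ i j → a i * b j) (2 ℕ.+ n)
    a′ b′ : ℕ → ℚ
    a′ j = ℕ→ℚ (suc j) * a (suc j)
    b′ j = ℕ→ℚ (suc j) * b (suc j)
    -- The range is extended by the term at `i = 0`, which has weight 0; `second` does the same at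
    -- `j = 0`.
    first : ℚΣ.splitSum (λ i j → a′ i * b j) (suc n) ≡ ℚΣ.splitSum (λ i j → ℕ→ℚ i * (a i * b j)) (2 ℕ.+ n)
    first = begin
      ℚΣ.splitSum (λ i j → a′ i * b j) (suc n)
        ≡⟨ ℚΣ.splitSum-cong (suc n) (λ i j _ → ℚₚ.*-assoc (ℕ→ℚ (suc i)) (a (suc i)) (b j)) ⟩
      ℚΣ.splitSum (λ i j → ℕ→ℚ (suc i) * (a (suc i) * b j)) (suc n)
        ≡⟨ ℚₚ.+-identityˡ _ ⟨
      0ℚ + ℚΣ.splitSum (λ i j → ℕ→ℚ (suc i) * (a (suc i) * b j)) (suc n)
        ≡⟨ cong₂ _+_ (ℚₚ.*-zeroˡ (a 0 * b (suc n))) refl ⟨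
      ℚΣ.splitSum (λ i j → ℕ→ℚ i * (a i * b j)) (2 ℕ.+ n) ∎
    second : ℚΣ.splitSum (λ i j → a i * b′ j) (suc n) ≡ ℚΣ.splitSum (λ i j → ℕ→ℚ j * (a i * b j)) (2 ℕ.+ n)
    second = begin
      ℚΣ.splitSum (λ i j → a i * b′ j) (suc n)
        ≡⟨ ℚΣ.splitSum-cong (suc n) (λ i j _ → solve 3 (λ x y z → x :* (y :* z) := y :* (x :* z)) refl (a i) (ℕ→ℚ (suc j)) (b (suc j))) ⟩
      ℚΣ.splitSum (λ i j → ℕ→ℚ (suc j) * (a i * b (suc j))) (suc n)
        ≡⟨ ℚₚ.+-identityʳ _ ⟨
      ℚΣ.splitSum (λ i j → ℕ→ℚ (suc j) * (a i * b (suc j))) (suc n) + 0ℚ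
        ≡⟨ cong (ℚΣ.splitSum (λ i j → ℕ→ℚ (suc j) * (a i * b (suc j))) (suc n) +_) (ℚₚ.*-zeroˡ (a (suc n) * b 0)) ⟨
      ℚΣ.splitSum (λ i j → ℕ→ℚ (suc j) * (a i * b (suc j))) (suc n) + ℕ→ℚ 0 * (a (suc n) * b 0)
        ≡⟨ ℚΣ.splitSum-snoc (λ i j → ℕ→ℚ j * (a i * b j)) (suc n) ⟨
      ℚΣ.splitSum (λ i j → ℕ→ℚ j * (a i * b j)) (2 ℕ.+ n) ∎
    collect : ∀ i j → suc (i ℕ.+ j) ≡ 2 ℕ.+ n →
              ℕ→ℚ i * (a i * b j) + ℕ→ℚ j * (a i * b j) ≡ ℕ→ℚ (suc n) * (a i * b j)
    collect i j i+j = begin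
      ℕ→ℚ i * (a i * b j) + ℕ→ℚ j * (a i * b j)  ≡⟨ ℚₚ.*-distribʳ-+ (a i * b j) (ℕ→ℚ i) (ℕ→ℚ j) ⟨
      (ℕ→ℚ i + ℕ→ℚ j) * (a i * b j)              ≡⟨ cong (_* (a i * b j)) (ℕ→ℚ-+ i j) ⟨
      ℕ→ℚ (i ℕ.+ j) * (a i * b j)                ≡⟨ cong (λ k → ℕ→ℚ k * (a i * b j)) (ℕₚ.suc-injective i+j) ⟩
      ℕ→ℚ (suc n) * (a i * b j)                  ∎

  -- The numerators of `sinCoeff` and `cosCoeff` as functions of the value of `half`, so that the
  -- parity argument needs no factorials.
  oddSign evenSign : Σ ℕ (λ _ → ℕ) → ℚ
  oddSign (q , 1) = sign q
  oddSign _       = 0ℚ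
  evenSign (q , 0) = sign q
  evenSign _       = 0ℚ

  sinEGF cosEGF tanEGF : ℕ → ℚ
  sinEGF = egf sinCoeff
  cosEGF = egf cosCoeff
  tanEGF = egf tanCoeff

  *-1/!-cancel : ∀ m x → ℕ→ℚ (m !) * (x * ((ℤ.+ 1) / (m !)) {{m ℕₚ.!≢0}}) ≡ x
  *-1/!-cancel m x = begin
    ℕ→ℚ (m !) * (x * r)  ≡⟨ solve 3 (λ a b c → a :* (b :* c) := (a :* c) :* b) refl (ℕ→ℚ (m !)) x r ⟩
    ℕ→ℚ (m !) * r * x    ≡⟨ cong (_* x) (1/!-inverse m) ⟩
    1ℚ * x               ≡⟨ ℚₚ.*-identityˡ x ⟩
    x                    ∎
    where r = ((ℤ.+ 1) / (m !)) {{m ℕₚ.!≢0}}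

  sinEGF-half : ∀ m → sinEGF m ≡ oddSign (half m)
  sinEGF-half m with half m
  ... | q , 0           = ℚₚ.*-zeroʳ (ℕ→ℚ (m !))
  ... | q , 1           = *-1/!-cancel m (sign q)
  ... | q , suc (suc _) = ℚₚ.*-zeroʳ (ℕ→ℚ (m !))

  cosEGF-half : ∀ m → cosEGF m ≡ evenSign (half m)
  cosEGF-half m with half m
  ... | q , 0           = *-1/!-cancel m (sign q)
  ... | q , suc _       = ℚₚ.*-zeroʳ (ℕ→ℚ (m !))

  oddSign-suc : ∀ q r → oddSign (suc q , r) ≡ - oddSign (q , r)
  oddSign-suc q 0             = refl
  oddSign-suc q 1             = refl
  oddSign-suc q (suc (suc _)) = refl

  evenSign-suc : ∀ q r → evenSign (suc q , r) ≡ - evenSign (q , r)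
  evenSign-suc q 0       = refl
  evenSign-suc q (suc _) = refl

  -- This is sin′ = cos on signs. `half` recurses in steps of two, and each such step negates both
  -- sides.
  oddSign-half-suc : ∀ m → oddSign (half (suc m)) ≡ evenSign (half m)
  oddSign-half-suc 0 = refl
  oddSign-half-suc 1 = refl
  oddSign-half-suc (suc (suc m)) with half (suc m) | half m | oddSign-half-suc m
  ... | q , r | q′ , r′ | ih = trans (oddSign-suc q r) (trans (cong -_ ih) (sym (evenSign-suc q′ r′)))

  evenSign-half-suc : ∀ m → evenSign (half (suc m)) ≡ - oddSign (half m)
  evenSign-half-suc 0 = refl
  evenSign-half-suc 1 = refl
  evenSign-half-suc (suc (suc m)) with half (suc m) | half m | evenSign-half-suc m
  ... | q , r | q′ , r′ | ih = trans (evenSign-suc q r) (cong -_ (trans ih (sym (oddSign-suc q′ r′))))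

  sinEGF-suc : ∀ m → sinEGF (suc m) ≡ cosEGF m
  sinEGF-suc m = trans (sinEGF-half (suc m)) (trans (oddSign-half-suc m) (sym (cosEGF-half m)))

  -- The sign is written as a scalar factor so that `⊛-scaleˡ` applies.
  cosEGF-suc : ∀ m → cosEGF (suc m) ≡ - 1ℚ * sinEGF m
  cosEGF-suc m = begin
    cosEGF (suc m)            ≡⟨ cosEGF-half (suc m) ⟩
    evenSign (half (suc m))   ≡⟨ evenSign-half-suc m ⟩
    - oddSign (half m)        ≡⟨ cong -_ (sinEGF-half m) ⟨
    - sinEGF m                ≡⟨ solve 1 (λ x → :- x := :- con 1ℚ :* x) refl (sinEGF m) ⟩
    - 1ℚ * sinEGF m           ∎

  mutual
    -- The convolution that defines tanCoeffs is private to Defs, so it is recovered by unification: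
    -- abstracting its arguments in tanCoeffs-suc makes the constraint on the metavariable a pattern.
    convolve : ℕ → List ℚ → ℚ
    convolve = _

    tanCoeffs-suc : ∀ m → tanCoeffs (suc m) ≡
                    (sinCoeff (suc m) - convolve 0 (tanCoeffs m)) ∷ tanCoeffs m
    tanCoeffs-suc m with sinCoeff (suc m) | tanCoeffs m | 0
    ... | s | ts | i = refl

  -- The list starts at its highest coefficient, so the cosine index grows along it from the offset
  -- `i`. The sum runs upwards, hence the head of the list becomes its last term.
  convolve-tanCoeffs : ∀ m i → convolve i (tanCoeffs m) ≡
    ℚΣ.splitSum (λ k k′ → tanCoeff k * cosCoeff (i ℕ.+ suc k′)) (suc m)
  convolve-tanCoeffs zero i = cong (λ j → tanCoeff 0 * cosCoeff j + 0ℚ) (ℕₚ.+-comm 1 i)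
  convolve-tanCoeffs (suc m) i = begin
    tanCoeff (suc m) * cosCoeff (suc i) + convolve (suc i) (tanCoeffs m)
      ≡⟨ ℚₚ.+-comm (tanCoeff (suc m) * cosCoeff (suc i)) (convolve (suc i) (tanCoeffs m)) ⟩
    convolve (suc i) (tanCoeffs m) + tanCoeff (suc m) * cosCoeff (suc i)
      ≡⟨ cong₂ _+_ (convolve-tanCoeffs m (suc i)) (cong (λ j → tanCoeff (suc m) * cosCoeff j) (ℕₚ.+-comm 1 i)) ⟩
    ℚΣ.splitSum (λ k k′ → tanCoeff k * cosCoeff (suc i ℕ.+ suc k′)) (suc m) + tanCoeff (suc m) * cosCoeff (i ℕ.+ 1)
      ≡⟨ cong (_+ (tanCoeff (suc m) * cosCoeff (i ℕ.+ 1)))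
           (ℚΣ.splitSum-cong (suc m) (λ k k′ _ → cong (λ j → tanCoeff k * cosCoeff j) (sym (ℕₚ.+-suc i (suc k′))))) ⟩
    ℚΣ.splitSum (λ k k′ → tanCoeff k * cosCoeff (i ℕ.+ suc (suc k′))) (suc m) + tanCoeff (suc m) * cosCoeff (i ℕ.+ 1)
      ≡⟨ ℚΣ.splitSum-snoc (λ k k′ → tanCoeff k * cosCoeff (i ℕ.+ suc k′)) (suc m) ⟨
    ℚΣ.splitSum (λ k k′ → tanCoeff k * cosCoeff (i ℕ.+ suc k′)) (2 ℕ.+ m) ∎

  -- The recursion for `tanCoeffs` solves this equation for its last term, where `cosCoeff 0`
  -- computes to 1.
  tanCoeff-sum : ∀ m → ℚΣ.splitSum (λ i j → tanCoeff i * cosCoeff j) (suc m) ≡ sinCoeff m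
  tanCoeff-sum zero    = refl
  tanCoeff-sum (suc m) = begin
    ℚΣ.splitSum (λ i j → tanCoeff i * cosCoeff j) (2 ℕ.+ m)
      ≡⟨ ℚΣ.splitSum-snoc (λ i j → tanCoeff i * cosCoeff j) (suc m) ⟩
    ℚΣ.splitSum (λ i j → tanCoeff i * cosCoeff (suc j)) (suc m) + tanCoeff (suc m) * cosCoeff 0
      ≡⟨ cong (_+ (tanCoeff (suc m) * cosCoeff 0)) (convolve-tanCoeffs m 0) ⟨
    c + (sinCoeff (suc m) - c) * 1ℚ
      ≡⟨ solve 2 (λ s c → c :+ (s :- c) :* con 1ℚ := s) refl (sinCoeff (suc m)) c ⟩
    sinCoeff (suc m) ∎
    where c = convolve 0 (tanCoeffs m)

  tan⊛cos : tanEGF ⊛ cosEGF ≗ sinEGF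
  tan⊛cos n = trans (egf-⊛ tanCoeff cosCoeff n) (cong (ℕ→ℚ (n !) *_) (tanCoeff-sum n))

  sincos sin² : ℕ → ℚ
  sincos = sinEGF ⊛ cosEGF
  sin²   = sinEGF ⊛ sinEGF

  -- The value at 0 is 1 and the derivative cancels.
  cos²+sin² : ∀ n → (cosEGF ⊛ cosEGF) n + sin² n ≡ δ n
  cos²+sin² zero    = refl
  cos²+sin² (suc n) = begin
    (((cosEGF ∘ suc) ⊛ cosEGF) n + (cosEGF ⊛ (cosEGF ∘ suc)) n) + (((sinEGF ∘ suc) ⊛ sinEGF) n + (sinEGF ⊛ (sinEGF ∘ suc)) n)
      ≡⟨ cong₂ _+_ (cong₂ _+_ left right)
           (cong₂ _+_ (trans (⊛-congˡ sinEGF sinEGF-suc n) (⊛-comm cosEGF sinEGF n)) (⊛-congʳ sinEGF sinEGF-suc n)) ⟩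
    (- 1ℚ * sincos n + - 1ℚ * sincos n) + (sincos n + sincos n)
      ≡⟨ solve 1 (λ x → (:- con 1ℚ :* x :+ :- con 1ℚ :* x) :+ (x :+ x) := con 0ℚ) refl (sincos n) ⟩
    0ℚ ∎
    where
    left : ((cosEGF ∘ suc) ⊛ cosEGF) n ≡ - 1ℚ * sincos n
    left = trans (⊛-congˡ cosEGF cosEGF-suc n) (⊛-scaleˡ (- 1ℚ) sinEGF cosEGF n)
    right : (cosEGF ⊛ (cosEGF ∘ suc)) n ≡ - 1ℚ * sincos n
    right = trans (⊛-comm cosEGF (cosEGF ∘ suc) n) left

  -- Replacing cos² by 1 - sin² in the derivative cos² - sin² leaves a system in `sincos` and `sin²`
  -- alone.
  sincos-suc : ∀ n → sincos (suc n) ≡ δ n + - 1ℚ * (sin² n + sin² n)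
  sincos-suc n = begin
    ((sinEGF ∘ suc) ⊛ cosEGF) n + (sinEGF ⊛ (cosEGF ∘ suc)) n
      ≡⟨ cong₂ _+_ (⊛-congˡ cosEGF sinEGF-suc n)
           (trans (⊛-comm sinEGF (cosEGF ∘ suc) n)
             (trans (⊛-congˡ sinEGF cosEGF-suc n) (⊛-scaleˡ (- 1ℚ) sinEGF sinEGF n))) ⟩
    c² + - 1ℚ * sin² n
      ≡⟨ solve 2 (λ c s → c :+ :- con 1ℚ :* s := (c :+ s) :+ :- con 1ℚ :* (s :+ s)) refl c² (sin² n) ⟩
    (c² + sin² n) + - 1ℚ * (sin² n + sin² n)
      ≡⟨ cong (_+ (- 1ℚ * (sin² n + sin² n))) (cos²+sin² n) ⟩
    δ n + - 1ℚ * (sin² n + sin² n) ∎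
    where c² = (cosEGF ⊛ cosEGF) n

  sin²-suc : ∀ n → sin² (suc n) ≡ sincos n + sincos n
  sin²-suc n = cong₂ _+_
    (trans (⊛-congˡ sinEGF sinEGF-suc n) (⊛-comm cosEGF sinEGF n))
    (⊛-congʳ sinEGF sinEGF-suc n)

  -- Multiply tan by 1 = cos² + sin² and use cos² tan = cos sin.
  tan-fixed : ∀ n → tanEGF n ≡ sincos n + (sin² ⊛ tanEGF) n
  tan-fixed n = begin
    tanEGF n
      ≡⟨ ⊛-identityˡ tanEGF n ⟨
    (δ ⊛ tanEGF) n
      ≡⟨ ⊛-congˡ tanEGF cos²+sin² n ⟨
    ((λ k → (cosEGF ⊛ cosEGF) k + sin² k) ⊛ tanEGF) n
      ≡⟨ ⊛-distribʳ-+ tanEGF (cosEGF ⊛ cosEGF) sin² n ⟩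
    ((cosEGF ⊛ cosEGF) ⊛ tanEGF) n + (sin² ⊛ tanEGF) n
      ≡⟨ cong (_+ (sin² ⊛ tanEGF) n) cos²tan ⟩
    sincos n + (sin² ⊛ tanEGF) n ∎
    where
    cos²tan : ((cosEGF ⊛ cosEGF) ⊛ tanEGF) n ≡ sincos n
    cos²tan = begin
      ((cosEGF ⊛ cosEGF) ⊛ tanEGF) n   ≡⟨ ⊛-comm (cosEGF ⊛ cosEGF) tanEGF n ⟩
      (tanEGF ⊛ (cosEGF ⊛ cosEGF)) n   ≡⟨ ⊛-assoc tanEGF cosEGF cosEGF n ⟨
      ((tanEGF ⊛ cosEGF) ⊛ cosEGF) n   ≡⟨ ⊛-congˡ cosEGF tan⊛cos n ⟩
      sincos n                         ∎

  -- The recurrence for chains of crossing chords and its solution.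

  -- The number of ways to complete a chord with d of the remaining k points on one side and e
  -- on the other to a sequence of chords in which consecutive chords cross.
  chains : ℕ → ℕ → ℕ → ℕ
  chains zero          d e = 1
  chains (suc zero)    d e = 0
  chains (suc (suc k)) d e =
    splitSum (λ i i′ → splitSum (λ j j′ → chains k (i ℕ.+ j) (i′ ℕ.+ j′)) e) d

  -- Exchanging the two sides of the first chord exchanges the order of summation; reversing both
  -- ranges then exchanges the two sides of the next chord.
  chains-sym : ∀ k d e → chains k d e ≡ chains k e d
  chains-sym zero          d e = refl
  chains-sym (suc zero)    d e = refl
  chains-sym (suc (suc k)) d e = begin
    splitSum (λ i i′ → splitSum (λ j j′ → chains k (i ℕ.+ j) (i′ ℕ.+ j′)) e) d
      ≡⟨ splitSum-swap (λ i i′ j j′ → chains k (i ℕ.+ j) (i′ ℕ.+ j′)) d e ⟩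
    splitSum (λ j j′ → splitSum (λ i i′ → chains k (i ℕ.+ j) (i′ ℕ.+ j′)) d) e
      ≡⟨ splitSum-flip (λ j j′ → splitSum (λ i i′ → chains k (i ℕ.+ j) (i′ ℕ.+ j′)) d) e ⟨
    splitSum (λ j j′ → splitSum (λ i i′ → chains k (i ℕ.+ j′) (i′ ℕ.+ j)) d) e
      ≡⟨ splitSum-cong e (λ j j′ _ → sym (splitSum-flip (λ i i′ → chains k (i ℕ.+ j′) (i′ ℕ.+ j)) d)) ⟩
    splitSum (λ j j′ → splitSum (λ i i′ → chains k (i′ ℕ.+ j′) (i ℕ.+ j)) d) e
      ≡⟨ splitSum-cong e (λ j j′ _ → splitSum-cong d (λ i i′ _ →
           trans (chains-sym k (i′ ℕ.+ j′) (i ℕ.+ j)) (cong₂ (chains k) (ℕₚ.+-comm i j) (ℕₚ.+-comm i′ j′)))) ⟩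
    splitSum (λ j j′ → splitSum (λ i i′ → chains k (j ℕ.+ i) (j′ ℕ.+ i′)) d) e ∎

  -- The first `d` terms of the antidiagonal total `splitSum (chains k) (d + e)`. Its own first
  -- difference is `chains k`, so the second difference of `chains (2 + k)` can be taken in two
  -- steps of first order.
  partialSum : ℕ → ℕ → ℕ → ℕ
  partialSum k d e = splitSum (λ i i′ → chains k i (i′ ℕ.+ e)) d

  partialSum-suc : ∀ k d e → partialSum k (suc d) e ≡ partialSum k d (suc e) ℕ.+ chains k d e
  partialSum-suc k d e = trans (splitSum-snoc (λ i i′ → chains k i (i′ ℕ.+ e)) d)
    (cong (ℕ._+ chains k d e) (splitSum-cong d (λ i i′ _ → cong (chains k i) (sym (ℕₚ.+-suc i′ e)))))

  -- The first difference of chains (2 + k), with the subtracted terms moved across.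
  chains-difference : ∀ k d e →
    chains (2 ℕ.+ k) (suc d) e ℕ.+ (partialSum k d e ℕ.+ partialSum k d e) ≡
    chains (2 ℕ.+ k) d (suc e) ℕ.+ splitSum (chains k) (d ℕ.+ e)
  chains-difference k d e = begin
    chains (2 ℕ.+ k) (suc d) e ℕ.+ (P ℕ.+ P)
      -- Both counts contain `inner`. The first adds the last row `edge`, the second the last column
      -- `P`, and `P` followed by `edge` is the whole antidiagonal.
      ≡⟨ cong (ℕ._+ (P ℕ.+ P)) (splitSum-snoc (λ i i′ → splitSum (λ j j′ → chains k (i ℕ.+ j) (i′ ℕ.+ j′)) e) d) ⟩
    (inner ℕ.+ edge) ℕ.+ (P ℕ.+ P)
      ≡⟨ ℕ-solve 3 (λ x y p → (x :+ᴺ y) :+ᴺ (p :+ᴺ p) :=ᴺ (x :+ᴺ p) :+ᴺ (p :+ᴺ y)) refl inner edge P ⟩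
    (inner ℕ.+ P) ℕ.+ (P ℕ.+ edge)
      ≡⟨ cong₂ ℕ._+_ (sym last-column) (sym (splitSum-++ (chains k) d e)) ⟩
    chains (2 ℕ.+ k) d (suc e) ℕ.+ splitSum (chains k) (d ℕ.+ e) ∎
    where
    open import Data.Nat.Solver using () renaming (module +-*-Solver to ℕ-Solver)
    open ℕ-Solver using () renaming (solve to ℕ-solve; _:+_ to _:+ᴺ_; _:=_ to _:=ᴺ_)
    P = partialSum k d e
    inner = splitSum (λ i i′ → splitSum (λ j j′ → chains k (i ℕ.+ j) (suc i′ ℕ.+ j′)) e) d
    edge = splitSum (λ j j′ → chains k (d ℕ.+ j) j′) e
    -- The last column meets the antidiagonal from its other end; the symmetry of `chains` and a
    -- reversal turn it into `P`.
    last-column : chains (2 ℕ.+ k) d (suc e) ≡ inner ℕ.+ P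
    last-column = begin
      chains (2 ℕ.+ k) d (suc e)
        ≡⟨ splitSum-cong d (λ i i′ _ → splitSum-snoc (λ j j′ → chains k (i ℕ.+ j) (i′ ℕ.+ j′)) e) ⟩
      splitSum (λ i i′ → splitSum (λ j j′ → chains k (i ℕ.+ j) (i′ ℕ.+ suc j′)) e ℕ.+ chains k (i ℕ.+ e) (i′ ℕ.+ 0)) d
        ≡⟨ splitSum-cong d (λ i i′ _ → cong₂ ℕ._+_
             (splitSum-cong e (λ j j′ _ → cong (chains k (i ℕ.+ j)) (ℕₚ.+-suc i′ j′)))
             (trans (chains-sym k (i ℕ.+ e) (i′ ℕ.+ 0)) (cong (λ x → chains k x (i ℕ.+ e)) (ℕₚ.+-identityʳ i′)))) ⟩
      splitSum (λ i i′ → splitSum (λ j j′ → chains k (i ℕ.+ j) (suc i′ ℕ.+ j′)) e ℕ.+ chains k i′ (i ℕ.+ e)) d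
        ≡⟨ splitSum-∙ (λ i i′ → splitSum (λ j j′ → chains k (i ℕ.+ j) (suc i′ ℕ.+ j′)) e) (λ i i′ → chains k i′ (i ℕ.+ e)) d ⟩
      inner ℕ.+ splitSum (λ i i′ → chains k i′ (i ℕ.+ e)) d
        ≡⟨ cong (inner ℕ.+_) (splitSum-flip (λ i i′ → chains k i (i′ ℕ.+ e)) d) ⟩
      inner ℕ.+ P ∎

  -- weight k = 2 ^ ⌊ k /2⌋ rescales the second difference of chains from −2 to −4.
  weight : ℕ → ℕ
  weight zero          = 1
  weight (suc zero)    = 1
  weight (suc (suc k)) = weight k ℕ.+ weight k

  β σ : ℕ → ℕ → ℕ → ℚ
  β k d e = ℕ→ℚ (weight k) * ℕ→ℚ (chains k d e)
  σ k d e = ℕ→ℚ (weight k) * ℕ→ℚ (partialSum k d e)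

  -- The index is one more than the number of remaining points, which aligns it with that of `T`.
  chainTotal : ℕ → ℚ
  chainTotal zero    = 0ℚ
  chainTotal (suc k) = ℕ→ℚ (weight k) * ℕ→ℚ (splitSum (chains k) (suc k))

  σ-suc : ∀ k d e → σ k (suc d) e ≡ σ k d (suc e) + β k d e
  σ-suc k d e = begin
    w * ℕ→ℚ (partialSum k (suc d) e)                          ≡⟨ cong (λ x → w * ℕ→ℚ x) (partialSum-suc k d e) ⟩
    w * ℕ→ℚ (partialSum k d (suc e) ℕ.+ chains k d e)
      ≡⟨ cong (w *_) (ℕ→ℚ-+ (partialSum k d (suc e)) (chains k d e)) ⟩
    w * (ℕ→ℚ (partialSum k d (suc e)) + ℕ→ℚ (chains k d e))
      ≡⟨ ℚₚ.*-distribˡ-+ w (ℕ→ℚ (partialSum k d (suc e))) (ℕ→ℚ (chains k d e)) ⟩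
    σ k d (suc e) + β k d e                                   ∎
    where w = ℕ→ℚ (weight k)

  -- From `k` to `2 + k` the weight doubles, so the 2 partial sums and the 1 total in
  -- `chains-difference` become 4 and 2.
  β-suc : ∀ k d e → d ℕ.+ e ≡ suc k →
          β (2 ℕ.+ k) (suc d) e + ((σ k d e + σ k d e) + (σ k d e + σ k d e)) ≡
          β (2 ℕ.+ k) d (suc e) + (chainTotal (suc k) + chainTotal (suc k))
  β-suc k d e d+e = begin
    ℕ→ℚ (weight k ℕ.+ weight k) * A + ((w * P + w * P) + (w * P + w * P))
      ≡⟨ cong (λ x → x * A + ((w * P + w * P) + (w * P + w * P))) (ℕ→ℚ-+ (weight k) (weight k)) ⟩
    (w + w) * A + ((w * P + w * P) + (w * P + w * P))
      ≡⟨ solve 3 (λ w a p → (w :+ w) :* a :+ ((w :* p :+ w :* p) :+ (w :* p :+ w :* p)) := (w :+ w) :* (a :+ (p :+ p)))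
           refl w A P ⟩
    (w + w) * (A + (P + P))
      ≡⟨ cong ((w + w) *_) difference ⟩
    (w + w) * (A′ + N)
      ≡⟨ solve 3 (λ w a n → (w :+ w) :* (a :+ n) := (w :+ w) :* a :+ (w :* n :+ w :* n)) refl w A′ N ⟩
    (w + w) * A′ + (w * N + w * N)
      ≡⟨ cong (λ x → x * A′ + (w * N + w * N)) (ℕ→ℚ-+ (weight k) (weight k)) ⟨
    ℕ→ℚ (weight k ℕ.+ weight k) * A′ + (w * N + w * N) ∎
    where
    w  = ℕ→ℚ (weight k)
    A  = ℕ→ℚ (chains (2 ℕ.+ k) (suc d) e)
    A′ = ℕ→ℚ (chains (2 ℕ.+ k) d (suc e))
    P  = ℕ→ℚ (partialSum k d e)
    N  = ℕ→ℚ (splitSum (chains k) (suc k))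
    p  = partialSum k d e
    difference : A + (P + P) ≡ A′ + N
    difference = begin
      A + (P + P)                                                ≡⟨ cong (A +_) (ℕ→ℚ-+ p p) ⟨
      A + ℕ→ℚ (p ℕ.+ p)
        ≡⟨ ℕ→ℚ-+ (chains (2 ℕ.+ k) (suc d) e) (p ℕ.+ p) ⟨
      ℕ→ℚ (chains (2 ℕ.+ k) (suc d) e ℕ.+ (p ℕ.+ p))             ≡⟨ cong ℕ→ℚ (chains-difference k d e) ⟩
      ℕ→ℚ (chains (2 ℕ.+ k) d (suc e) ℕ.+ splitSum (chains k) (d ℕ.+ e))
        ≡⟨ cong (λ n → ℕ→ℚ (chains (2 ℕ.+ k) d (suc e) ℕ.+ splitSum (chains k) n)) d+e ⟩
      ℕ→ℚ (chains (2 ℕ.+ k) d (suc e) ℕ.+ splitSum (chains k) (suc k))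
        ≡⟨ ℕ→ℚ-+ (chains (2 ℕ.+ k) d (suc e)) (splitSum (chains k) (suc k)) ⟩
      A′ + N ∎

  -- The derivative of order `e` of S, which is the coefficient of vᵉ / e! in S (u + v).
  totalFrom : ℕ → ℕ → ℚ
  totalFrom e k = chainTotal (e ℕ.+ k)

  -- The Taylor coefficients at uᵈ vᵉ / d! e! of sin u cos u + sin² u · S (u + v) and of
  -- cos 2u + sin 2u · S (u + v), where S is the generating function of chainTotal.
  σEGF βEGF : ℕ → ℕ → ℚ
  σEGF d e = δ e * sincos d + (sin² ⊛ totalFrom e) d
  βEGF d e = δ e * (δ d + - 1ℚ * (sin² d + sin² d)) + ((sincos ⊛ totalFrom e) d + (sincos ⊛ totalFrom e) d)

  ⊛-totalFrom : ∀ f e → f ⊛ (totalFrom e ∘ suc) ≗ f ⊛ totalFrom (suc e)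
  ⊛-totalFrom f e = ⊛-congʳ f (λ k → cong chainTotal (ℕₚ.+-suc e k))

  -- This is ∂ᵤσ = ∂ᵥσ + β. The two partial derivatives of S (u + v) agree, so only (sin u cos u)′ =
  -- cos 2u and (sin² u)′ = sin 2u remain.
  σEGF-suc : ∀ d e → σEGF (suc d) e ≡ σEGF d (suc e) + βEGF d e
  σEGF-suc d e = begin
    δ e * sincos (suc d) + (((sin² ∘ suc) ⊛ totalFrom e) d + (sin² ⊛ (totalFrom e ∘ suc)) d)
      ≡⟨ cong₂ _+_ (cong (δ e *_) (sincos-suc d)) (cong₂ _+_
           (trans (⊛-congˡ (totalFrom e) sin²-suc d) (⊛-distribʳ-+ (totalFrom e) sincos sincos d))
           (⊛-totalFrom sin² e d)) ⟩
    δ e * c + ((s + s) + q)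
      -- The summand `con 0ℚ :* p` is `δ (suc e) * sincos d` in `σEGF d (suc e)`.
      ≡⟨ solve 5 (λ x c s q p → x :* c :+ ((s :+ s) :+ q) := (con 0ℚ :* p :+ q) :+ (x :* c :+ (s :+ s)))
           refl (δ e) c s q (sincos d) ⟩
    σEGF d (suc e) + βEGF d e ∎
    where
    c = δ d + - 1ℚ * (sin² d + sin² d)
    s = (sincos ⊛ totalFrom e) d
    q = (sin² ⊛ totalFrom (suc e)) d

  -- This is ∂ᵤβ + 4σ = ∂ᵥβ + 2 S (u + v), from (cos 2u)′ = -4 sin u cos u and (sin 2u)′ = 2 - 4
  -- sin² u.
  βEGF-suc : ∀ d e → βEGF (suc d) e + ((σEGF d e + σEGF d e) + (σEGF d e + σEGF d e)) ≡
                  βEGF d (suc e) + (chainTotal (e ℕ.+ d) + chainTotal (e ℕ.+ d))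
  βEGF-suc d e = begin
    βEGF (suc d) e + ((σEGF d e + σEGF d e) + (σEGF d e + σEGF d e))
      ≡⟨ cong (_+ ((σEGF d e + σEGF d e) + (σEGF d e + σEGF d e))) (cong₂ _+_
           (cong (λ x → δ e * (0ℚ + - 1ℚ * (x + x))) (sin²-suc d)) (cong₂ _+_ derivative derivative)) ⟩
    (δ e * (0ℚ + - 1ℚ * ((p + p) + (p + p))) + (((t + - 1ℚ * (q + q)) + s) + ((t + - 1ℚ * (q + q)) + s)))
      + ((σEGF d e + σEGF d e) + (σEGF d e + σEGF d e))
      ≡⟨ solve 6 (λ x p t q s c →
           (x :* (con 0ℚ :+ :- con 1ℚ :* ((p :+ p) :+ (p :+ p)))
              :+ (((t :+ :- con 1ℚ :* (q :+ q)) :+ s) :+ ((t :+ :- con 1ℚ :* (q :+ q)) :+ s)))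
             :+ (((x :* p :+ q) :+ (x :* p :+ q)) :+ ((x :* p :+ q) :+ (x :* p :+ q)))
           := (con 0ℚ :* c :+ (s :+ s)) :+ (t :+ t))
           refl (δ e) p t q s (δ d + - 1ℚ * (sin² d + sin² d)) ⟩
    βEGF d (suc e) + (t + t) ∎
    where
    p = sincos d
    t = chainTotal (e ℕ.+ d)
    q = (sin² ⊛ totalFrom e) d
    s = (sincos ⊛ totalFrom (suc e)) d
    derivative : ((sincos ∘ suc) ⊛ totalFrom e) d + (sincos ⊛ (totalFrom e ∘ suc)) d ≡ (t + - 1ℚ * (q + q)) + s
    derivative = cong₂ _+_ (begin
      ((sincos ∘ suc) ⊛ totalFrom e) d
        ≡⟨ ⊛-congˡ (totalFrom e) sincos-suc d ⟩
      ((λ k → δ k + - 1ℚ * (sin² k + sin² k)) ⊛ totalFrom e) d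
        ≡⟨ ⊛-distribʳ-+ (totalFrom e) δ (λ k → - 1ℚ * (sin² k + sin² k)) d ⟩
      (δ ⊛ totalFrom e) d + ((λ k → - 1ℚ * (sin² k + sin² k)) ⊛ totalFrom e) d
        ≡⟨ cong₂ _+_ (⊛-identityˡ (totalFrom e) d) (⊛-scaleˡ (- 1ℚ) (λ k → sin² k + sin² k) (totalFrom e) d) ⟩
      t + - 1ℚ * ((λ k → sin² k + sin² k) ⊛ totalFrom e) d
        ≡⟨ cong (λ x → t + - 1ℚ * x) (⊛-distribʳ-+ (totalFrom e) sin² sin² d) ⟩
      t + - 1ℚ * (q + q) ∎) (⊛-totalFrom sincos e d)

  σEGF-zero : ∀ e → σEGF 0 e ≡ 0ℚ
  σEGF-zero e = solve 2 (λ x t → x :* con 0ℚ :+ con 0ℚ :* t := con 0ℚ) refl (δ e) (totalFrom e 0)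

  -- No chord crosses one with an empty side. At `d = e = 0` the value is 1 instead, the completed
  -- chain.
  βEGF-zero : ∀ e → βEGF 0 (suc e) ≡ 0ℚ
  βEGF-zero e = solve 1 (λ t → con 0ℚ :+ (con 0ℚ :* t :+ con 0ℚ :* t) := con 0ℚ) refl (totalFrom (suc e) 0)

  σ≡σEGF : ∀ k → (∀ d e → d ℕ.+ e ≡ k → β k d e ≡ βEGF d e) → ∀ d e → d ℕ.+ e ≡ suc k → σ k d e ≡ σEGF d e
  σ≡σEGF k β≡βEGF zero    e _   = trans (ℚₚ.*-zeroʳ (ℕ→ℚ (weight k))) (sym (σEGF-zero e))
  σ≡σEGF k β≡βEGF (suc d) e d+e = begin
    σ k (suc d) e            ≡⟨ σ-suc k d e ⟩
    σ k d (suc e) + β k d e  ≡⟨ cong₂ _+_ (σ≡σEGF k β≡βEGF d (suc e) (trans (ℕₚ.+-suc d e) d+e))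
                                          (β≡βEGF d e (ℕₚ.suc-injective d+e)) ⟩
    σEGF d (suc e) + βEGF d e      ≡⟨ σEGF-suc d e ⟨
    σEGF (suc d) e              ∎

  -- Along each antidiagonal both sides satisfy the same difference equation and start from the same
  -- value at `d = 0`. The equation refers to `σ` two levels down, which `σ≡σEGF` obtains from `β`
  -- there.
  β≡βEGF : ∀ k d e → d ℕ.+ e ≡ k → β k d e ≡ βEGF d e
  β≡βEGF zero zero zero refl = refl
  β≡βEGF (suc zero) zero (suc zero) refl = refl
  β≡βEGF (suc zero) (suc zero) zero refl = refl
  β≡βEGF (suc (suc k)) zero (suc e) _ = trans (ℚₚ.*-zeroʳ (ℕ→ℚ (weight (2 ℕ.+ k)))) (sym (βEGF-zero e))
  β≡βEGF (suc (suc k)) (suc d) e d+e = begin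
    β (2 ℕ.+ k) (suc d) e
      -- The difference equations avoid subtraction, so 4σ is added and removed around their use.
      ≡⟨ solve 2 (λ b s → b := (b :+ ((s :+ s) :+ (s :+ s))) :- ((s :+ s) :+ (s :+ s)))
           refl (β (2 ℕ.+ k) (suc d) e) (σ k d e) ⟩
    (β (2 ℕ.+ k) (suc d) e + ((σ k d e + σ k d e) + (σ k d e + σ k d e))) - ((σ k d e + σ k d e) + (σ k d e + σ k d e))
      ≡⟨ cong₂ _-_ (trans (β-suc k d e d+e′) (cong₂ _+_ (β≡βEGF (suc (suc k)) d (suc e) (trans (ℕₚ.+-suc d e) d+e)) refl))
                   (cong (λ s → (s + s) + (s + s)) (σ≡σEGF k (β≡βEGF k) d e d+e′)) ⟩
    (βEGF d (suc e) + (chainTotal (suc k) + chainTotal (suc k))) - ((σEGF d e + σEGF d e) + (σEGF d e + σEGF d e))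
      ≡⟨ cong (λ n → (βEGF d (suc e) + (chainTotal n + chainTotal n)) - ((σEGF d e + σEGF d e) + (σEGF d e + σEGF d e)))
           (trans (sym d+e′) (ℕₚ.+-comm d e)) ⟩
    (βEGF d (suc e) + (chainTotal (e ℕ.+ d) + chainTotal (e ℕ.+ d))) - ((σEGF d e + σEGF d e) + (σEGF d e + σEGF d e))
      ≡⟨ cong (_- ((σEGF d e + σEGF d e) + (σEGF d e + σEGF d e))) (βEGF-suc d e) ⟨
    (βEGF (suc d) e + ((σEGF d e + σEGF d e) + (σEGF d e + σEGF d e))) - ((σEGF d e + σEGF d e) + (σEGF d e + σEGF d e))
      ≡⟨ solve 2 (λ b s → (b :+ ((s :+ s) :+ (s :+ s))) :- ((s :+ s) :+ (s :+ s)) := b)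
           refl (βEGF (suc d) e) (σEGF d e) ⟩
    βEGF (suc d) e ∎
    where d+e′ = ℕₚ.suc-injective d+e

  -- Set v = 0: for `e = 0` the partial sum is the whole total.
  chainTotal-fixed : ∀ n → chainTotal n ≡ sincos n + (sin² ⊛ chainTotal) n
  chainTotal-fixed zero    = refl
  chainTotal-fixed (suc k) = begin
    ℕ→ℚ (weight k) * ℕ→ℚ (splitSum (chains k) (suc k))
      ≡⟨ cong (λ n → ℕ→ℚ (weight k) * ℕ→ℚ n) (splitSum-cong (suc k) (λ i i′ _ → cong (chains k i) (sym (ℕₚ.+-identityʳ i′)))) ⟩
    σ k (suc k) 0
      ≡⟨ σ≡σEGF k (β≡βEGF k) (suc k) 0 (ℕₚ.+-identityʳ (suc k)) ⟩
    1ℚ * sincos (suc k) + (sin² ⊛ chainTotal) (suc k)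
      ≡⟨ cong (_+ (sin² ⊛ chainTotal) (suc k)) (ℚₚ.*-identityˡ (sincos (suc k))) ⟩
    sincos (suc k) + (sin² ⊛ chainTotal) (suc k) ∎

  -- Since sin² has no constant term, the equation shared by both sequences determines each value
  -- from earlier ones.
  chainTotal≡tan : ∀ n → chainTotal n ≡ T n
  chainTotal≡tan = <-rec (λ n → chainTotal n ≡ T n) (λ n rec → begin
    chainTotal n                      ≡⟨ chainTotal-fixed n ⟩
    sincos n + (sin² ⊛ chainTotal) n  ≡⟨ cong (sincos n +_) (⊛-congʳ-< sin² n refl (λ k k<n → rec k<n)) ⟩
    sincos n + (sin² ⊛ tanEGF) n      ≡⟨ tan-fixed n ⟨
    tanEGF n                          ∎)

open import Data.Nat using (_+_; _*_; _∸_; _^_)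
open import Data.Nat.Solver using (module +-*-Solver)
open import Data.Rational using (ℚ) renaming (_*_ to _*ℚ_)
open SplitSum ℕₚ.+-0-isCommutativeMonoid
open Tangent using (chains; chains-sym; weight; chainTotal; chainTotal≡tan; ℕ→ℚ-*)

-- Cardinalities

private variable
  A B′ : Set

HasCard-cong : {P Q : A → Set} {k : ℕ} → (∀ {x} → P x → Q x) → (∀ {x} → Q x → P x) →
               HasCard P k → HasCard Q k
HasCard-cong P⇒Q Q⇒P (xs , xs! , ∈⇔P , len) =
  xs , xs! , (λ x → mk⇔ (P⇒Q ∘′ Equivalence.to (∈⇔P x)) (Equivalence.from (∈⇔P x) ∘′ Q⇒P)) , len

HasCard-∅ : {P : A → Set} → (∀ {x} → ¬ P x) → HasCard P 0
HasCard-∅ ¬P = [] , [] , (λ x → mk⇔ (λ ()) (⊥-elim ∘′ ¬P)) , refl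

HasCard-singleton : ∀ (x : A) → HasCard (_≡ x) 1
HasCard-singleton x =
  x ∷ [] , [] ∷ [] , (λ y → mk⇔ (λ { (here eq) → eq ; (there ()) }) here) , refl

HasCard-⊎ : {P Q : A → Set} {m n : ℕ} → (∀ {x} → P x → ¬ Q x) →
            HasCard P m → HasCard Q n → HasCard (λ x → P x ⊎ Q x) (m + n)
HasCard-⊎ disj (xs , xs! , ∈⇔P , refl) (ys , ys! , ∈⇔Q , refl) =
  xs ++ ys ,
  Uniqueₚ.++⁺ xs! ys! (λ (x∈xs , x∈ys) → disj (Equivalence.to (∈⇔P _) x∈xs) (Equivalence.to (∈⇔Q _) x∈ys)) ,
  (λ x → mk⇔
    (λ x∈ → [ inj₁ ∘′ Equivalence.to (∈⇔P x) , inj₂ ∘′ Equivalence.to (∈⇔Q x) ]′ (∈-++⁻ xs x∈))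
    [ ∈-++⁺ˡ ∘′ Equivalence.from (∈⇔P x) , ∈-++⁺ʳ xs ∘′ Equivalence.from (∈⇔Q x) ]′) ,
  Listₚ.length-++ xs

HasCard-map : {P : A → Set} {k : ℕ} (f : A → B′) → (∀ {x y} → f x ≡ f y → x ≡ y) →
              HasCard P k → HasCard (λ y → ∃ λ x → y ≡ f x × P x) k
HasCard-map f f-inj (xs , xs! , ∈⇔P , len) =
  map f xs , Uniqueₚ.map⁺ f-inj xs! ,
  (λ y → mk⇔
    (λ y∈ → let (x , x∈ , y≡fx) = ∈-map⁻ f y∈ in x , y≡fx , Equivalence.to (∈⇔P x) x∈)
    (λ { (x , refl , Px) → ∈-map⁺ f (Equivalence.from (∈⇔P x) Px) })) ,
  trans (Listₚ.length-map f xs) len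

-- Surjectivity is asked only on `P`, since arrays of a fixed width reach only column lists of that
-- length.
HasCard-comap : {P : B′ → Set} {k : ℕ} (f : A → B′) → (∀ {x y} → f x ≡ f y → x ≡ y) →
                (∀ {y} → P y → ∃ λ x → f x ≡ y) → HasCard P k → HasCard (P ∘ f) k
HasCard-comap {A = A} {P = P} f f-inj f-sur (ys , ys! , ∈⇔P , len) =
  xs , Uniqueₚ.map⁻ (subst Unique (sym map-xs) ys!) ,
  (λ x → mk⇔
    (λ x∈ → Equivalence.to (∈⇔P (f x)) (subst (f x ∈_) map-xs (∈-map⁺ f x∈)))
    (λ Pfx → let (x′ , x′∈ , fx≡fx′) = ∈-map⁻ f (subst (f x ∈_) (sym map-xs) (Equivalence.from (∈⇔P (f x)) Pfx))
             in subst (_∈ xs) (sym (f-inj fx≡fx′)) x′∈)) ,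
  trans (sym (Listₚ.length-map f xs)) (trans (cong length map-xs) len)
  where
  preimages : ∀ ys → All P ys → Σ (List A) λ xs → map f xs ≡ ys
  preimages []       []         = [] , refl
  preimages (y ∷ ys) (Py ∷ Pys) =
    let (x , fx≡y) = f-sur Py ; (xs , eq) = preimages ys Pys in x ∷ xs , cong₂ _∷_ fx≡y eq
  xs     = proj₁ (preimages ys (All.tabulate (λ {y} → Equivalence.to (∈⇔P y))))
  map-xs = proj₂ (preimages ys (All.tabulate (λ {y} → Equivalence.to (∈⇔P y))))

-- The choice of one point `v` of `l`. The lengths of the two remaining pieces become the indices of
-- `splitSum`.
Splits : List ℕ → (List ℕ → ℕ → List ℕ → A → Set) → A → Set
Splits l P x = ∃ λ l₁ → ∃ λ v → ∃ λ l₂ → l ≡ l₁ ++ v ∷ l₂ × P l₁ v l₂ x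

-- In a duplicate-free list the point determines the split, so disjointness reduces to recovering
-- `v` from `x`.
HasCard-Splits : ∀ l {P : List ℕ → ℕ → List ℕ → A → Set} (f : ℕ → ℕ → ℕ) → Unique l →
  (∀ l₁ v l₂ → l ≡ l₁ ++ v ∷ l₂ → HasCard (P l₁ v l₂) (f (length l₁) (length l₂))) →
  (∀ {l₁ v l₂ l₁′ v′ l₂′ x} → l ≡ l₁ ++ v ∷ l₂ → l ≡ l₁′ ++ v′ ∷ l₂′ →
     P l₁ v l₂ x → P l₁′ v′ l₂′ x → v ≡ v′) →
  HasCard (Splits l P) (splitSum f (length l))
HasCard-Splits [] f _ card disj = HasCard-∅ λ { ([] , _ , _ , () , _) ; (_ ∷ _ , _ , _ , () , _) }
HasCard-Splits (h ∷ t) {P} f (h∉t ∷ t!) card disj =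
  HasCard-cong
    (λ { (inj₁ p) → [] , h , t , refl , p
       ; (inj₂ (l₁ , v , l₂ , eq , p)) → h ∷ l₁ , v , l₂ , cong (h ∷_) eq , p })
    (λ { ([] , v , l₂ , refl , p) → inj₁ p
       ; (_ ∷ l₁ , v , l₂ , refl , p) → inj₂ (l₁ , v , l₂ , refl , p) })
    (HasCard-⊎
      (λ { p (l₁ , v , l₂ , refl , q) →
           Allₚ.All¬⇒¬Any h∉t (subst (_∈ t) (sym (disj {[]} {h} {t} {h ∷ l₁} {v} {l₂} refl refl p q)) (∈-insert l₁)) })
      (card [] h t refl)
      (HasCard-Splits t {λ l₁ → P (h ∷ l₁)} (f ∘ suc) t!
        (λ l₁ v l₂ eq → card (h ∷ l₁) v l₂ (cong (h ∷_) eq))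
        (λ eq eq′ → disj (cong (h ∷_) eq) (cong (h ∷_) eq′))))

-- Pieces as crossing chords

Column : Set
Column = ℕ × ℕ

tile : Column → Column → Piece
tile (a , b) (a′ , b′) = a ∷ a′ ∷ b ∷ b′ ∷ []

-- true puts the larger label on top
orient : Bool → ℕ → ℕ → Column
orient true  lo hi = hi , lo
orient false lo hi = lo , hi

orient-injective : ∀ {o o′ a b c d} → a < b → c < d → orient o a b ≡ orient o′ c d →
                   o ≡ o′ × a ≡ c × b ≡ d
orient-injective {true}  {true}  a<b c<d refl = refl , refl , refl
orient-injective {true}  {false} a<b c<d refl = ⊥-elim (ℕₚ.<-asym a<b c<d)
orient-injective {false} {true}  a<b c<d refl = ⊥-elim (ℕₚ.<-asym a<b c<d)
orient-injective {false} {false} a<b c<d refl = refl , refl , refl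

-- Orientations follow `orient`; `rising` says that the left chord is the lower one. In all eight
-- pieces the columns are the chords 1-3 and 2-4, and these three bits tell the pieces apart.
leftSide rightSide rising : Letter → Bool
leftSide B  = true
leftSide E  = true
leftSide G  = true
leftSide J  = true
leftSide R  = false
leftSide T' = false
leftSide V  = false
leftSide Y  = false
rightSide B  = true
rightSide E  = false
rightSide G  = true
rightSide J  = false
rightSide R  = true
rightSide T' = false
rightSide V  = true
rightSide Y  = false
rising B  = true
rising E  = true
rising G  = false
rising J  = false
rising R  = true
rising T' = true
rising V  = false
rising Y  = false

data Crossing (o′ o : Bool) : Bool → Column → Column → Set where
  below : ∀ {u lo v hi} → u < lo → lo < v → v < hi → Crossing o′ o true  (orient o′ u v) (orient o lo hi)
  above : ∀ {lo v hi u} → lo < v → v < hi → hi < u → Crossing o′ o false (orient o′ v u) (orient o lo hi)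

module _ {a b c d} (a<b : a < b) (b<c : b < c) (c<d : c < d) where
  private
    <ᵇ-true : ∀ {m n} → m < n → (m <ᵇ n) ≡ true
    <ᵇ-true {m} {n} m<n with m <ᵇ n | ℕₚ.<⇒<ᵇ m<n
    ... | true | _ = refl
    <ᵇ-false : ∀ {m n} → n ≤ m → (m <ᵇ n) ≡ false
    <ᵇ-false {m} {n} n≤m with m <ᵇ n | ℕₚ.<ᵇ⇒< m n
    ... | false | _   = refl
    ... | true  | m<n = ⊥-elim (ℕₚ.<-irrefl refl (ℕₚ.<-≤-trans (m<n _) n≤m))
    a<c = ℕₚ.<-trans a<b b<c
    b<d = ℕₚ.<-trans b<c c<d
    a<d = ℕₚ.<-trans a<b b<d

  -- The order of the labels decides all sixteen comparisons made by `reduce`; once these are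
  -- rewritten, it computes.
  reduce-crossing : ∀ l →
    reduce (if rising l then tile (orient (leftSide l) a c) (orient (rightSide l) b d)
                        else tile (orient (leftSide l) b d) (orient (rightSide l) a c)) ≡ std l
  reduce-crossing l
    with e₁ ← <ᵇ-true a<b | e₂ ← <ᵇ-true a<c | e₃ ← <ᵇ-true a<d
       | e₄ ← <ᵇ-true b<c | e₅ ← <ᵇ-true b<d | e₆ ← <ᵇ-true c<d
       | f₁ ← <ᵇ-false (ℕₚ.<⇒≤ a<b) | f₂ ← <ᵇ-false (ℕₚ.<⇒≤ a<c) | f₃ ← <ᵇ-false (ℕₚ.<⇒≤ a<d)
       | f₄ ← <ᵇ-false (ℕₚ.<⇒≤ b<c) | f₅ ← <ᵇ-false (ℕₚ.<⇒≤ b<d) | f₆ ← <ᵇ-false (ℕₚ.<⇒≤ c<d)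
       | g₁ ← <ᵇ-false {a} ℕₚ.≤-refl | g₂ ← <ᵇ-false {b} ℕₚ.≤-refl
       | g₃ ← <ᵇ-false {c} ℕₚ.≤-refl | g₄ ← <ᵇ-false {d} ℕₚ.≤-refl
    with l
  ... | B  rewrite e₁ | e₂ | e₃ | e₄ | e₅ | e₆ | f₁ | f₂ | f₃ | f₄ | f₅ | f₆ | g₁ | g₂ | g₃ | g₄ = refl
  ... | E  rewrite e₁ | e₂ | e₃ | e₄ | e₅ | e₆ | f₁ | f₂ | f₃ | f₄ | f₅ | f₆ | g₁ | g₂ | g₃ | g₄ = refl
  ... | G  rewrite e₁ | e₂ | e₃ | e₄ | e₅ | e₆ | f₁ | f₂ | f₃ | f₄ | f₅ | f₆ | g₁ | g₂ | g₃ | g₄ = refl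
  ... | J  rewrite e₁ | e₂ | e₃ | e₄ | e₅ | e₆ | f₁ | f₂ | f₃ | f₄ | f₅ | f₆ | g₁ | g₂ | g₃ | g₄ = refl
  ... | R  rewrite e₁ | e₂ | e₃ | e₄ | e₅ | e₆ | f₁ | f₂ | f₃ | f₄ | f₅ | f₆ | g₁ | g₂ | g₃ | g₄ = refl
  ... | T' rewrite e₁ | e₂ | e₃ | e₄ | e₅ | e₆ | f₁ | f₂ | f₃ | f₄ | f₅ | f₆ | g₁ | g₂ | g₃ | g₄ = refl
  ... | V  rewrite e₁ | e₂ | e₃ | e₄ | e₅ | e₆ | f₁ | f₂ | f₃ | f₄ | f₅ | f₆ | g₁ | g₂ | g₃ | g₄ = refl
  ... | Y  rewrite e₁ | e₂ | e₃ | e₄ | e₅ | e₆ | f₁ | f₂ | f₃ | f₄ | f₅ | f₆ | g₁ | g₂ | g₃ | g₄ = refl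

Crossing⇒reduce : ∀ l {y x} → Crossing (leftSide l) (rightSide l) (rising l) y x →
                  reduce (tile y x) ≡ std l
Crossing⇒reduce B  (below p q r) = reduce-crossing p q r B
Crossing⇒reduce E  (below p q r) = reduce-crossing p q r E
Crossing⇒reduce G  (above p q r) = reduce-crossing p q r G
Crossing⇒reduce J  (above p q r) = reduce-crossing p q r J
Crossing⇒reduce R  (below p q r) = reduce-crossing p q r R
Crossing⇒reduce T' (below p q r) = reduce-crossing p q r T'
Crossing⇒reduce V  (above p q r) = reduce-crossing p q r V
Crossing⇒reduce Y  (above p q r) = reduce-crossing p q r Y

rank : ∀ {n} → Vec ℕ n → ℕ → ℕ
rank p x = suc (count (_<? x) p)

count-mono : ∀ {n} (p : Vec ℕ n) {x y} → x ≤ y → count (_<? x) p ≤ count (_<? y) p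
count-mono []      x≤y = z≤n
count-mono (w ∷ p) {x} {y} x≤y
  with w <ᵇ x | w <ᵇ y | (λ w<x → ℕₚ.<⇒<ᵇ (ℕₚ.<-≤-trans (ℕₚ.<ᵇ⇒< w x w<x) x≤y))
... | true  | true  | _  = s≤s (count-mono p x≤y)
... | true  | false | ⇒⊥ = ⊥-elim (⇒⊥ _)
... | false | true  | _  = ℕₚ.m≤n⇒m≤1+n (count-mono p x≤y)
... | false | false | _  = count-mono p x≤y

-- Ranks are monotone in the label, so `y ≤ x` would contradict the larger rank of `y`.
rank-reflects-< : ∀ {n} (p : Vec ℕ n) {x y r} → rank p x ≡ r → rank p y ≡ suc r → x < y
rank-reflects-< p {x} {y} refl eq = ℕₚ.≰⇒> λ y≤x →
  ℕₚ.<-irrefl eq (s≤s (s≤s (count-mono p y≤x)))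

∷₄-injective : ∀ {a b c d a′ b′ c′ d′ : ℕ} → _≡_ {A = Piece}
  (a ∷ b ∷ c ∷ d ∷ []) (a′ ∷ b′ ∷ c′ ∷ d′ ∷ []) → a ≡ a′ × b ≡ b′ × c ≡ c′ × d ≡ d′
∷₄-injective refl = refl , refl , refl , refl

-- The rank equations `a`, `b`, `c`, `d` belong to top-left, top-right, bottom-left and
-- bottom-right. Taken in order of rank, neighbouring ones give the three inequalities.
reduce⇒Crossing : ∀ l {y x} → reduce (tile y x) ≡ std l →
                  Crossing (leftSide l) (rightSide l) (rising l) y x
reduce⇒Crossing B  {y} {x} eq with a , b , c , d ← ∷₄-injective eq =
  below (rank-reflects-< (tile y x) c d) (rank-reflects-< (tile y x) d a) (rank-reflects-< (tile y x) a b)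
reduce⇒Crossing E  {y} {x} eq with a , b , c , d ← ∷₄-injective eq =
  below (rank-reflects-< (tile y x) c b) (rank-reflects-< (tile y x) b a) (rank-reflects-< (tile y x) a d)
reduce⇒Crossing G  {y} {x} eq with a , b , c , d ← ∷₄-injective eq =
  above (rank-reflects-< (tile y x) d c) (rank-reflects-< (tile y x) c b) (rank-reflects-< (tile y x) b a)
reduce⇒Crossing J  {y} {x} eq with a , b , c , d ← ∷₄-injective eq =
  above (rank-reflects-< (tile y x) b c) (rank-reflects-< (tile y x) c d) (rank-reflects-< (tile y x) d a)
reduce⇒Crossing R  {y} {x} eq with a , b , c , d ← ∷₄-injective eq =
  below (rank-reflects-< (tile y x) a d) (rank-reflects-< (tile y x) d c) (rank-reflects-< (tile y x) c b)
reduce⇒Crossing T' {y} {x} eq with a , b , c , d ← ∷₄-injective eq =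
  below (rank-reflects-< (tile y x) a b) (rank-reflects-< (tile y x) b c) (rank-reflects-< (tile y x) c d)
reduce⇒Crossing V  {y} {x} eq with a , b , c , d ← ∷₄-injective eq =
  above (rank-reflects-< (tile y x) d a) (rank-reflects-< (tile y x) a b) (rank-reflects-< (tile y x) b c)
reduce⇒Crossing Y  {y} {x} eq with a , b , c , d ← ∷₄-injective eq =
  above (rank-reflects-< (tile y x) b a) (rank-reflects-< (tile y x) a d) (rank-reflects-< (tile y x) d c)

Ok : List Letter → Column → Column → Set
Ok W y x = Any (λ l → reduce (tile y x) ≡ std l) W

-- Exactly one letter of `W` fits each right orientation `o` and relative position `s`, so
-- orientations propagate from right to left without choice.
record Deterministic (W : List Letter) : Set where
  field
    pick           : Bool → Bool → Letter
    pick∈          : ∀ o s → pick o s ∈ W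
    rightSide-pick : ∀ o s → rightSide (pick o s) ≡ o
    rising-pick    : ∀ o s → rising (pick o s) ≡ s
    pick-unique    : All (λ l → l ≡ pick (rightSide l) (rising l)) W

  previous : Bool → Bool → Bool
  previous o s = leftSide (pick o s)

  Crossing⇒Ok : ∀ o s {y x} → Crossing (previous o s) o s y x → Ok W y x
  Crossing⇒Ok o s {y} {x} c = lose (pick∈ o s)
    (Crossing⇒reduce (pick o s)
      (subst₂ (λ o′ s′ → Crossing (previous o s) o′ s′ y x) (sym (rightSide-pick o s)) (sym (rising-pick o s)) c))

  Ok⇒Crossing : ∀ {y x} → Ok W y x → ∃ λ o → ∃ λ s → Crossing (previous o s) o s y x
  Ok⇒Crossing {y} {x} ok with find ok
  ... | l , l∈W , eq = rightSide l , rising l ,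
    subst (λ l′ → Crossing (leftSide l′) (rightSide l) (rising l) y x)
          (All.lookup pick-unique l∈W) (reduce⇒Crossing l eq)

sixWords-deterministic : ∀ {W} → W ∈ sixWords → Deterministic W
sixWords-deterministic (here refl) = record
  { pick           = λ { true true → B ; true false → G ; false true → E ; false false → J }
  ; pick∈          = λ { true true → here refl ; true false → there (there (here refl))
                       ; false true → there (here refl) ; false false → there (there (there (here refl))) }
  ; rightSide-pick = λ { true true → refl ; true false → refl ; false true → refl ; false false → refl }
  ; rising-pick    = λ { true true → refl ; true false → refl ; false true → refl ; false false → refl }
  ; pick-unique    = refl ∷ refl ∷ refl ∷ refl ∷ [] }
sixWords-deterministic (there (here refl)) = record
  { pick           = λ { true true → B ; true false → G ; false true → E ; false false → Y }
  ; pick∈          = λ { true true → here refl ; true false → there (there (here refl))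
                       ; false true → there (here refl) ; false false → there (there (there (here refl))) }
  ; rightSide-pick = λ { true true → refl ; true false → refl ; false true → refl ; false false → refl }
  ; rising-pick    = λ { true true → refl ; true false → refl ; false true → refl ; false false → refl }
  ; pick-unique    = refl ∷ refl ∷ refl ∷ refl ∷ [] }
sixWords-deterministic (there (there (here refl))) = record
  { pick           = λ { true true → B ; true false → V ; false true → E ; false false → J }
  ; pick∈          = λ { true true → here refl ; true false → there (there (there (here refl)))
                       ; false true → there (here refl) ; false false → there (there (here refl)) }
  ; rightSide-pick = λ { true true → refl ; true false → refl ; false true → refl ; false false → refl }
  ; rising-pick    = λ { true true → refl ; true false → refl ; false true → refl ; false false → refl }
  ; pick-unique    = refl ∷ refl ∷ refl ∷ refl ∷ [] }
sixWords-deterministic (there (there (there (here refl)))) = record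
  { pick           = λ { true true → B ; true false → V ; false true → E ; false false → Y }
  ; pick∈          = λ { true true → here refl ; true false → there (there (here refl))
                       ; false true → there (here refl) ; false false → there (there (there (here refl))) }
  ; rightSide-pick = λ { true true → refl ; true false → refl ; false true → refl ; false false → refl }
  ; rising-pick    = λ { true true → refl ; true false → refl ; false true → refl ; false false → refl }
  ; pick-unique    = refl ∷ refl ∷ refl ∷ refl ∷ [] }
sixWords-deterministic (there (there (there (there (here refl))))) = record
  { pick           = λ { true true → B ; true false → V ; false true → T' ; false false → J }
  ; pick∈          = λ { true true → here refl ; true false → there (there (there (here refl)))
                       ; false true → there (there (here refl)) ; false false → there (here refl) }
  ; rightSide-pick = λ { true true → refl ; true false → refl ; false true → refl ; false false → refl }
  ; rising-pick    = λ { true true → refl ; true false → refl ; false true → refl ; false false → refl }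
  ; pick-unique    = refl ∷ refl ∷ refl ∷ refl ∷ [] }
sixWords-deterministic (there (there (there (there (there (here refl)))))) = record
  { pick           = λ { true true → R ; true false → V ; false true → E ; false false → J }
  ; pick∈          = λ { true true → there (there (here refl)) ; true false → there (there (there (here refl)))
                       ; false true → here refl ; false false → there (here refl) }
  ; rightSide-pick = λ { true true → refl ; true false → refl ; false true → refl ; false false → refl }
  ; rising-pick    = λ { true true → refl ; true false → refl ; false true → refl ; false false → refl }
  ; pick-unique    = refl ∷ refl ∷ refl ∷ refl ∷ [] }

-- Counting chains of crossing chords

Sorted : List ℕ → Set
Sorted = AllPairs _<_

module _ {A : Set} {R : A → A → Set} where
  AllPairs-delete : ∀ xs {y ys} → AllPairs R (xs ++ y ∷ ys) → AllPairs R (xs ++ ys)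
  AllPairs-delete []       (_ ∷ pys)  = pys
  AllPairs-delete (x ∷ xs) (px ∷ pxs) =
    Allₚ.++⁺ (Allₚ.++⁻ˡ xs px) (All.tail (Allₚ.++⁻ʳ xs px)) ∷ AllPairs-delete xs pxs

  AllPairs-before : ∀ xs {y ys} → AllPairs R (xs ++ y ∷ ys) → All (λ x → R x y) xs
  AllPairs-before []       _          = []
  AllPairs-before (x ∷ xs) (px ∷ pxs) = All.head (Allₚ.++⁻ʳ xs px) ∷ AllPairs-before xs pxs

  AllPairs-after : ∀ xs {y ys} → AllPairs R (xs ++ y ∷ ys) → All (R y) ys
  AllPairs-after []       (py ∷ _)  = py
  AllPairs-after (x ∷ xs) (_ ∷ pxs) = AllPairs-after xs pxs

  AllPairs-++⁻ˡ : ∀ xs {ys} → AllPairs R (xs ++ ys) → AllPairs R xs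
  AllPairs-++⁻ˡ []       _          = []
  AllPairs-++⁻ˡ (x ∷ xs) (px ∷ pxs) = Allₚ.++⁻ˡ xs px ∷ AllPairs-++⁻ˡ xs pxs

  AllPairs-++⁻ʳ : ∀ xs {ys} → AllPairs R (xs ++ ys) → AllPairs R ys
  AllPairs-++⁻ʳ []       pys       = pys
  AllPairs-++⁻ʳ (x ∷ xs) (_ ∷ pxs) = AllPairs-++⁻ʳ xs pxs

Sorted⇒Unique : ∀ {xs} → Sorted xs → Unique xs
Sorted⇒Unique = AllPairs.map ℕₚ.<⇒≢

extract₂ : ∀ {A : Set} (l m r : List A) {a b} → l ++ a ∷ m ++ b ∷ r ↭ a ∷ b ∷ l ++ m ++ r
extract₂ l m r {a} {b} = ↭-trans (shift a l (m ++ b ∷ r)) (prep a (↭-trans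
  (↭-reflexive (sym (Listₚ.++-assoc l m (b ∷ r))))
  (↭-trans (shift b (l ++ m) r) (prep b (↭-reflexive (Listₚ.++-assoc l m r))))))

-- Once `u` and `v` are chosen, the free points are seen as those before, inside and after the new
-- chord.
regroup-below : ∀ {A : Set} (l₁ l₂ m₁ m₂ r : List A) {u v} →
  (l₁ ++ u ∷ l₂) ++ (m₁ ++ v ∷ m₂) ++ r ≡ l₁ ++ u ∷ (l₂ ++ m₁) ++ v ∷ (m₂ ++ r)
regroup-below l₁ l₂ m₁ m₂ r {u} {v} = trans (Listₚ.++-assoc l₁ (u ∷ l₂) _)
  (cong (λ xs → l₁ ++ u ∷ xs) (trans (cong (l₂ ++_) (Listₚ.++-assoc m₁ (v ∷ m₂) r)) (sym (Listₚ.++-assoc l₂ m₁ _))))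

regroup-above : ∀ {A : Set} (l m₁ m₂ r₁ r₂ : List A) {v u} →
  l ++ (m₁ ++ v ∷ m₂) ++ (r₁ ++ u ∷ r₂) ≡ (l ++ m₁) ++ v ∷ (m₂ ++ r₁) ++ u ∷ r₂
regroup-above l m₁ m₂ r₁ r₂ {v} {u} = trans
  (cong (l ++_) (trans (Listₚ.++-assoc m₁ (v ∷ m₂) _) (cong (λ xs → m₁ ++ v ∷ xs) (sym (Listₚ.++-assoc m₂ r₁ _)))))
  (sym (Listₚ.++-assoc l m₁ _))

flatten : List Column → List ℕ
flatten []             = []
flatten ((a , b) ∷ cs) = a ∷ b ∷ flatten cs

flatten-orient : ∀ o a b cs → flatten (orient o a b ∷ cs) ↭ a ∷ b ∷ flatten cs
flatten-orient true  a b cs = _↭_.swap b a ↭-refl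
flatten-orient false a b cs = ↭-refl

module Bounds {l m r lo hi} (sorted : Sorted (l ++ lo ∷ m ++ hi ∷ r)) where
  private
    sorted′ : Sorted (lo ∷ m ++ hi ∷ r)
    sorted′ = AllPairs-++⁻ʳ l sorted
    inner = AllPairs.tail sorted′

  l<lo : All (_< lo) l
  l<lo = AllPairs-before l sorted
  lo<m : All (lo <_) m
  lo<m = Allₚ.++⁻ˡ m (AllPairs.head sorted′)
  lo<hi : lo < hi
  lo<hi = All.head (Allₚ.++⁻ʳ m (AllPairs.head sorted′))
  m<hi : All (_< hi) m
  m<hi = AllPairs-before m inner
  hi<r : All (hi <_) r
  hi<r = AllPairs-after m inner

  rest-sorted : Sorted (l ++ m ++ r)
  rest-sorted = subst Sorted (Listₚ.++-assoc l m r)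
    (AllPairs-delete (l ++ m) (subst Sorted (sym (Listₚ.++-assoc l m (hi ∷ r))) (AllPairs-delete l sorted)))

  ∈-l : ∀ {u} → u ∈ l ++ m ++ r → u < lo → u ∈ l
  ∈-l u∈ u<lo with ∈-++⁻ l u∈
  ... | inj₁ u∈l = u∈l
  ... | inj₂ u∈mr with ∈-++⁻ m u∈mr
  ... | inj₁ u∈m = ⊥-elim (ℕₚ.<-asym u<lo (All.lookup lo<m u∈m))
  ... | inj₂ u∈r = ⊥-elim (ℕₚ.<-asym u<lo (ℕₚ.<-trans lo<hi (All.lookup hi<r u∈r)))

  ∈-m : ∀ {v} → v ∈ l ++ m ++ r → lo < v → v < hi → v ∈ m
  ∈-m v∈ lo<v v<hi with ∈-++⁻ l v∈
  ... | inj₁ v∈l = ⊥-elim (ℕₚ.<-asym lo<v (All.lookup l<lo v∈l))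
  ... | inj₂ v∈mr with ∈-++⁻ m v∈mr
  ... | inj₁ v∈m = v∈m
  ... | inj₂ v∈r = ⊥-elim (ℕₚ.<-asym v<hi (All.lookup hi<r v∈r))

  ∈-r : ∀ {u} → u ∈ l ++ m ++ r → hi < u → u ∈ r
  ∈-r u∈ hi<u with ∈-++⁻ l u∈
  ... | inj₁ u∈l = ⊥-elim (ℕₚ.<-asym hi<u (ℕₚ.<-trans (All.lookup l<lo u∈l) lo<hi))
  ... | inj₂ u∈mr with ∈-++⁻ m u∈mr
  ... | inj₁ u∈m = ⊥-elim (ℕₚ.<-asym hi<u (All.lookup m<hi u∈m))
  ... | inj₂ u∈r = u∈r

-- This closes the line to a circle: the outer points are read downward from the lower endpoint,
-- then from the top down to the upper endpoint. In that order the partners below and above form one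
-- range. For a partner above, the inside of the new chord is the opposite side, hence `chains-sym`.
chains-around : ∀ k i i′ a b →
  splitSum (λ j j′ → chains k (j′ + i) (j + (i′ + b))) a + splitSum (λ j j′ → chains k (i′ + j) ((a + i) + j′)) b ≡
  splitSum (λ j j′ → chains k (i + j) (i′ + j′)) (a + b)
chains-around k i i′ a b = begin
  splitSum (λ j j′ → chains k (j′ + i) (j + (i′ + b))) a + splitSum (λ j j′ → chains k (i′ + j) ((a + i) + j′)) b
    ≡⟨ cong₂ _+_ (splitSum-flip (λ j j′ → chains k (j + i) (j′ + (i′ + b))) a)
                 (splitSum-flip (λ j j′ → chains k (i′ + j′) ((a + i) + j)) b) ⟩
  splitSum (λ j j′ → chains k (j + i) (j′ + (i′ + b))) a + splitSum (λ j j′ → chains k (i′ + j′) ((a + i) + j)) b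
    ≡⟨ cong₂ _+_
         (splitSum-cong a (λ j j′ _ → cong₂ (chains k) (ℕₚ.+-comm j i)
           (solve 3 (λ j′ i′ b → j′ :+ (i′ :+ b) := i′ :+ (j′ :+ b)) refl j′ i′ b)))
         (splitSum-cong b (λ j j′ _ → trans (chains-sym k (i′ + j′) ((a + i) + j))
           (cong (λ x → chains k x (i′ + j′)) (solve 3 (λ a i j → (a :+ i) :+ j := i :+ (a :+ j)) refl a i j)))) ⟩
  splitSum (λ j j′ → chains k (i + j) (i′ + (j′ + b))) a + splitSum (λ j j′ → chains k (i + (a + j)) (i′ + j′)) b
    ≡⟨ splitSum-++ (λ j j′ → chains k (i + j) (i′ + j′)) a b ⟨
  splitSum (λ j j′ → chains k (i + j) (i′ + j′)) (a + b) ∎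
  where
  open +-*-Solver

module Count {W : List Letter} (det : Deterministic W) where
  open Deterministic det

  -- Columns are listed from right to left, since W determines the left side of a piece from
  -- its right side but not conversely.
  Chain : List Column → Set
  Chain = Linked (flip (Ok W))

  -- Here `cs` holds the columns to the left of the current one, nearest first; `l`, `m`, `r` are
  -- the free points before, between and after its labels.
  Completes : Bool → (l : List ℕ) (lo : ℕ) (m : List ℕ) (hi : ℕ) (r : List ℕ) → List Column → Set
  Completes o l lo m hi r cs = Chain (orient o lo hi ∷ cs) × flatten cs ↭ l ++ m ++ r

  module Step {o : Bool} {l lo m hi r} (sorted : Sorted (l ++ lo ∷ m ++ hi ∷ r)) where
    open Bounds {l} {m} {r} sorted

    o↑ = previous o true
    o↓ = previous o false

    Below Above : List ℕ → ℕ → List ℕ → List Column → Set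
    Below m₁ v m₂ = Splits l λ l₁ u l₂ cs → ∃ λ cs′ →
      cs ≡ orient o↑ u v ∷ cs′ × Completes o↑ l₁ u (l₂ ++ m₁) v (m₂ ++ r) cs′
    Above m₁ v m₂ = Splits r λ r₁ u r₂ cs → ∃ λ cs′ →
      cs ≡ orient o↓ v u ∷ cs′ × Completes o↓ (l ++ m₁) v (m₂ ++ r₁) u r₂ cs′

    -- The endpoint inside the current chord is chosen first and its partner second, as in the
    -- nested sums of `chains`.
    Next : List Column → Set
    Next = Splits m λ m₁ v m₂ cs → Below m₁ v m₂ cs ⊎ Above m₁ v m₂ cs

    below-bounds : ∀ {m₁ v m₂ l₁ u l₂} → m ≡ m₁ ++ v ∷ m₂ → l ≡ l₁ ++ u ∷ l₂ → u < lo × lo < v × v < hi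
    below-bounds {m₁ = m₁} {l₁ = l₁} refl refl =
      All.lookup l<lo (∈-insert l₁) , All.lookup lo<m (∈-insert m₁) , All.lookup m<hi (∈-insert m₁)

    above-bounds : ∀ {m₁ v m₂ r₁ u r₂} → m ≡ m₁ ++ v ∷ m₂ → r ≡ r₁ ++ u ∷ r₂ → lo < v × v < hi × hi < u
    above-bounds {m₁ = m₁} {r₁ = r₁} refl refl =
      All.lookup lo<m (∈-insert m₁) , All.lookup m<hi (∈-insert m₁) , All.lookup hi<r (∈-insert r₁)

    Next⇒Completes : ∀ {cs} → Next cs → Completes o l lo m hi r cs
    Next⇒Completes (m₁ , v , m₂ , refl , inj₁ (l₁ , u , l₂ , refl , cs , refl , chain , perm)) =
      let u<lo , lo<v , v<hi = below-bounds refl refl in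
      Crossing⇒Ok o true (below u<lo lo<v v<hi) ∷ chain ,
      ↭-trans (flatten-orient o↑ u v cs) (↭-trans (prep u (prep v perm))
        (↭-trans (↭-sym (extract₂ l₁ (l₂ ++ m₁) (m₂ ++ r))) (↭-reflexive (sym (regroup-below l₁ l₂ m₁ m₂ r)))))
    Next⇒Completes (m₁ , v , m₂ , refl , inj₂ (r₁ , u , r₂ , refl , cs , refl , chain , perm)) =
      let lo<v , v<hi , hi<u = above-bounds refl refl in
      Crossing⇒Ok o false (above lo<v v<hi hi<u) ∷ chain ,
      ↭-trans (flatten-orient o↓ v u cs) (↭-trans (prep v (prep u perm))
        (↭-trans (↭-sym (extract₂ (l ++ m₁) (m₂ ++ r₁) r₂)) (↭-reflexive (sym (regroup-above l m₁ m₂ r₁ r₂)))))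

    ∷-Completes⇒Next : ∀ {y cs} → Completes o l lo m hi r (y ∷ cs) → Next (y ∷ cs)
    ∷-Completes⇒Next {y} {cs} (ok ∷ chain , perm) = next (Ok⇒Crossing ok) refl
      where
      -- The right column is a variable with an equation, so that matching on `Crossing` need not
      -- unify two applications of `orient`.
      next : ∀ {x} → (∃ λ o′ → ∃ λ s → Crossing (previous o′ s) o′ s y x) → x ≡ orient o lo hi → Next (y ∷ cs)
      next (o′ , true , below {u} {lo′} {v} {hi′} u<lo lo<v v<hi) eq
        with refl , refl , refl ← orient-injective {o′} {o} (ℕₚ.<-trans lo<v v<hi) lo<hi eq
        with perm′ ← ↭-trans (↭-sym (flatten-orient o↑ u v cs)) perm
        with m₁ , m₂ , refl ← ∈-∃++ (∈-m (∈-resp-↭ perm′ (there (here refl))) lo<v v<hi)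
           | l₁ , l₂ , refl ← ∈-∃++ (∈-l (∈-resp-↭ perm′ (here refl)) u<lo) =
        m₁ , v , m₂ , refl , inj₁ (l₁ , u , l₂ , refl , cs , refl , chain ,
          drop-∷ (drop-∷ (↭-trans perm′ (↭-trans (↭-reflexive (regroup-below l₁ l₂ m₁ m₂ r))
            (extract₂ l₁ (l₂ ++ m₁) (m₂ ++ r))))))
      next (o′ , false , above {lo′} {v} {hi′} {u} lo<v v<hi hi<u) eq
        with refl , refl , refl ← orient-injective {o′} {o} (ℕₚ.<-trans lo<v v<hi) lo<hi eq
        with perm′ ← ↭-trans (↭-sym (flatten-orient o↓ v u cs)) perm
        with m₁ , m₂ , refl ← ∈-∃++ (∈-m (∈-resp-↭ perm′ (here refl)) lo<v v<hi)
           | r₁ , r₂ , refl ← ∈-∃++ (∈-r (∈-resp-↭ perm′ (there (here refl))) hi<u) =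
        m₁ , v , m₂ , refl , inj₂ (r₁ , u , r₂ , refl , cs , refl , chain ,
          drop-∷ (drop-∷ (↭-trans perm′ (↭-trans (↭-reflexive (regroup-above l m₁ m₂ r₁ r₂))
            (extract₂ (l ++ m₁) (m₂ ++ r₁) r₂)))))

    Completes⇒Next : ∀ {k} → length (l ++ m ++ r) ≡ suc k → ∀ {cs} → Completes o l lo m hi r cs → Next cs
    Completes⇒Next len {[]}    (_ , perm) with () ← trans (↭-length perm) len
    Completes⇒Next len {_ ∷ _} completes = ∷-Completes⇒Next completes

    Middle : ℕ → List Column → Set
    Middle v cs = (lo < v × v < hi) ×
      ((∃ λ u → ∃ λ cs′ → u < lo × cs ≡ orient o↑ u v ∷ cs′) ⊎
       (∃ λ u → ∃ λ cs′ → hi < u × cs ≡ orient o↓ v u ∷ cs′))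

    Next⇒Middle : ∀ {m₁ v m₂ cs} → m ≡ m₁ ++ v ∷ m₂ → Below m₁ v m₂ cs ⊎ Above m₁ v m₂ cs → Middle v cs
    Next⇒Middle m≡ (inj₁ (_ , u , _ , l≡ , cs′ , cs≡ , _)) =
      let u<lo , bounds = below-bounds m≡ l≡ in bounds , inj₁ (u , cs′ , u<lo , cs≡)
    Next⇒Middle m≡ (inj₂ (_ , u , _ , r≡ , cs′ , cs≡ , _)) =
      let lo<v , v<hi , hi<u = above-bounds m≡ r≡ in (lo<v , v<hi) , inj₂ (u , cs′ , hi<u , cs≡)

    -- The first column has exactly one label strictly between `lo` and `hi`; the other lies
    -- outside.
    Middle-unique : ∀ {v v′ cs} → Middle v cs → Middle v′ cs → v ≡ v′
    Middle-unique ((lo<v , _) , inj₁ (_ , _ , u<lo , refl)) ((lo<v′ , _) , inj₁ (_ , _ , u′<lo , eq)) =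
      proj₂ (proj₂ (orient-injective {o↑} {o↑} (ℕₚ.<-trans u<lo lo<v) (ℕₚ.<-trans u′<lo lo<v′) (Listₚ.∷-injectiveˡ eq)))
    Middle-unique ((_ , v<hi) , inj₂ (_ , _ , hi<u , refl)) ((_ , v′<hi) , inj₂ (_ , _ , hi<u′ , eq)) =
      proj₁ (proj₂ (orient-injective {o↓} {o↓} (ℕₚ.<-trans v<hi hi<u) (ℕₚ.<-trans v′<hi hi<u′) (Listₚ.∷-injectiveˡ eq)))
    Middle-unique ((lo<v , _) , inj₁ (_ , _ , u<lo , refl)) ((lo<v′ , v′<hi) , inj₂ (_ , _ , hi<u′ , eq)) =
      ⊥-elim (ℕₚ.<-asym u<lo (subst (lo <_) (sym (proj₁ (proj₂ (orient-injective {o↑} {o↓}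
        (ℕₚ.<-trans u<lo lo<v) (ℕₚ.<-trans v′<hi hi<u′) (Listₚ.∷-injectiveˡ eq))))) lo<v′))
    Middle-unique ((lo<v , v<hi) , inj₂ (_ , _ , hi<u , refl)) ((lo<v′ , _) , inj₁ (_ , _ , u′<lo , eq)) =
      ⊥-elim (ℕₚ.<-asym u′<lo (subst (lo <_) (proj₁ (proj₂ (orient-injective {o↓} {o↑}
        (ℕₚ.<-trans v<hi hi<u) (ℕₚ.<-trans u′<lo lo<v′) (Listₚ.∷-injectiveˡ eq)))) lo<v))

    ¬Below×Above : ∀ {m₁ v m₂ cs} → m ≡ m₁ ++ v ∷ m₂ → Below m₁ v m₂ cs → ¬ Above m₁ v m₂ cs
    ¬Below×Above m≡ (_ , _ , _ , l≡ , _ , refl , _) (_ , _ , _ , r≡ , _ , eq , _) =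
      let u<lo , lo<v , _ = below-bounds m≡ l≡ ; _ , v<hi , hi<u′ = above-bounds m≡ r≡ in
      ℕₚ.<-irrefl (proj₁ (proj₂ (orient-injective {o↑} {o↓} (ℕₚ.<-trans u<lo lo<v) (ℕₚ.<-trans v<hi hi<u′)
        (Listₚ.∷-injectiveˡ eq)))) (ℕₚ.<-trans u<lo lo<v)

  CountCompletes : ℕ → Set
  CountCompletes k = ∀ {l m r lo hi} o → Sorted (l ++ lo ∷ m ++ hi ∷ r) → length (l ++ m ++ r) ≡ k →
    HasCard (Completes o l lo m hi r) (chains k (length m) (length l + length r))

  module _ {k} (ih : CountCompletes k) {o : Bool} {l m r lo hi} (sorted : Sorted (l ++ lo ∷ m ++ hi ∷ r))
           (len : length (l ++ m ++ r) ≡ 2 + k) where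
    open Bounds {l} {m} {r} sorted
    open Step {o} {l} {lo} {m} {hi} {r} sorted

    private
      length-extracted : ∀ l′ m′ r′ {a b} → l ++ m ++ r ≡ l′ ++ a ∷ m′ ++ b ∷ r′ → length (l′ ++ m′ ++ r′) ≡ k
      length-extracted l′ m′ r′ eq = ℕₚ.suc-injective (ℕₚ.suc-injective
        (trans (sym (↭-length (extract₂ l′ m′ r′))) (trans (cong length (sym eq)) len)))

    HasCard-below : ∀ m₁ v m₂ → m ≡ m₁ ++ v ∷ m₂ → HasCard (Below m₁ v m₂)
      (splitSum (λ j j′ → chains k (j′ + length m₁) (j + (length m₂ + length r))) (length l))
    HasCard-below m₁ v m₂ m≡ = HasCard-Splits l _ (Sorted⇒Unique (AllPairs-++⁻ˡ l sorted))
      (λ l₁ u l₂ l≡ →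
        let regroup = trans (cong₂ (λ l m → l ++ m ++ r) l≡ m≡) (regroup-below l₁ l₂ m₁ m₂ r) in
        HasCard-map (orient o↑ u v ∷_) Listₚ.∷-injectiveʳ
          (subst (HasCard (Completes o↑ l₁ u (l₂ ++ m₁) v (m₂ ++ r)))
            (cong₂ (chains k) (Listₚ.length-++ l₂) (cong (length l₁ +_) (Listₚ.length-++ m₂)))
            (ih o↑ (subst Sorted regroup rest-sorted) (length-extracted l₁ (l₂ ++ m₁) (m₂ ++ r) regroup))))
      (λ { l≡ l≡′ (_ , refl , _) (_ , eq , _) →
        let u<lo , lo<v , _ = below-bounds m≡ l≡ ; u′<lo , _ = below-bounds m≡ l≡′ in
        proj₁ (proj₂ (orient-injective {o↑} {o↑} (ℕₚ.<-trans u<lo lo<v) (ℕₚ.<-trans u′<lo lo<v) (Listₚ.∷-injectiveˡ eq))) })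

    HasCard-above : ∀ m₁ v m₂ → m ≡ m₁ ++ v ∷ m₂ → HasCard (Above m₁ v m₂)
      (splitSum (λ j j′ → chains k (length m₂ + j) ((length l + length m₁) + j′)) (length r))
    HasCard-above m₁ v m₂ m≡ =
      HasCard-Splits r _ (AllPairs.tail (AllPairs-++⁻ʳ m (AllPairs.tail (AllPairs-++⁻ʳ l (Sorted⇒Unique sorted)))))
      (λ r₁ u r₂ r≡ →
        let regroup = trans (cong₂ (λ m r → l ++ m ++ r) m≡ r≡) (regroup-above l m₁ m₂ r₁ r₂) in
        HasCard-map (orient o↓ v u ∷_) Listₚ.∷-injectiveʳ
          (subst (HasCard (Completes o↓ (l ++ m₁) v (m₂ ++ r₁) u r₂))
            (cong₂ (chains k) (Listₚ.length-++ m₂) (cong (_+ length r₂) (Listₚ.length-++ l)))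
            (ih o↓ (subst Sorted regroup rest-sorted) (length-extracted (l ++ m₁) (m₂ ++ r₁) r₂ regroup))))
      (λ { r≡ r≡′ (_ , refl , _) (_ , eq , _) →
        let _ , v<hi , hi<u = above-bounds m≡ r≡ ; _ , _ , hi<u′ = above-bounds m≡ r≡′ in
        proj₂ (proj₂ (orient-injective {o↓} {o↓} (ℕₚ.<-trans v<hi hi<u) (ℕₚ.<-trans v<hi hi<u′) (Listₚ.∷-injectiveˡ eq))) })

    HasCard-step : HasCard (Completes o l lo m hi r) (chains (2 + k) (length m) (length l + length r))
    HasCard-step = HasCard-cong Next⇒Completes (Completes⇒Next len)
      (subst (HasCard Next)
        (splitSum-cong (length m) (λ i i′ _ → chains-around k i i′ (length l) (length r)))
        (HasCard-Splits m _ (AllPairs-++⁻ˡ m (AllPairs.tail (AllPairs-++⁻ʳ l (Sorted⇒Unique sorted))))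
          (λ m₁ v m₂ m≡ → HasCard-⊎ (¬Below×Above m≡) (HasCard-below m₁ v m₂ m≡) (HasCard-above m₁ v m₂ m≡))
          (λ m≡ m≡′ p q → Middle-unique (Next⇒Middle m≡ p) (Next⇒Middle m≡′ q))))

  -- The clauses follow those of `chains`: no free point leaves only the empty list, a single one
  -- cannot form a column, and otherwise a next column uses up two.
  HasCard-Completes : ∀ k → CountCompletes k
  HasCard-Completes zero {l} {m} {r} o sorted len with l ++ m ++ r | len
  ... | [] | _ = HasCard-cong (λ { refl → [-] , ↭-refl })
    (λ { {[]} _ → refl ; {_ ∷ _} (_ , perm) → ⊥-elim (ℕₚ.1+n≢0 (↭-length perm)) })
    (HasCard-singleton [])
  HasCard-Completes (suc zero) o sorted len = HasCard-∅ λ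
    { {[]}    (_ , perm) → ℕₚ.0≢1+n (trans (↭-length perm) len)
    ; {_ ∷ _} (_ , perm) → ℕₚ.1+n≢0 (ℕₚ.suc-injective (trans (↭-length perm) len)) }
  HasCard-Completes (suc (suc k)) o sorted len = HasCard-step (HasCard-Completes k) sorted len

-- Puzzles as chains

-- A chord with `j` points outside can have them distributed before and after it in `suc j` ways.
splitSum-rotate : ∀ g k → splitSum (λ i i′ → splitSum (λ j j′ → g j (i + j′)) i′) (suc k) ≡
                          splitSum (λ i j → suc j * g i j) k
splitSum-rotate g zero    = refl
splitSum-rotate g (suc k) = begin
  splitSum g (suc k) + splitSum (λ i i′ → splitSum (λ j j′ → g j (suc (i + j′))) i′) (suc k)
    ≡⟨ cong₂ _+_ (splitSum-snoc g k) (splitSum-rotate (λ i j → g i (suc j)) k) ⟩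
  (x + g k 0) + y
    ≡⟨ solve 3 (λ x c y → (x :+ c) :+ y := (x :+ y) :+ con 1 :* c) refl x (g k 0) y ⟩
  (x + y) + 1 * g k 0
    ≡⟨ cong (_+ (1 * g k 0)) (splitSum-∙ (λ i j → g i (suc j)) (λ i j → suc j * g i (suc j)) k) ⟨
  splitSum (λ i j → suc (suc j) * g i (suc j)) k + 1 * g k 0
    ≡⟨ splitSum-snoc (λ i j → suc j * g i j) k ⟨
  splitSum (λ i j → suc j * g i j) (suc k) ∎
  where
  open +-*-Solver
  x = splitSum (λ i j → g i (suc j)) k
  y = splitSum (λ i j → suc j * g i (suc j)) k

-- By symmetry the weight `suc j` may be traded for `suc i`, and the two add up to `suc k`. The
-- doubling comes from the two orientations of the starting column.
splitSum-average : ∀ g k → (∀ i j → g i j ≡ g j i) →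
  splitSum (λ i j → suc j * g i j) k + splitSum (λ i j → suc j * g i j) k ≡ suc k * splitSum g k
splitSum-average g k g-sym = begin
  splitSum (λ i j → suc j * g i j) k + splitSum (λ i j → suc j * g i j) k
    ≡⟨ cong (splitSum (λ i j → suc j * g i j) k +_) (splitSum-flip (λ i j → suc j * g i j) k) ⟨
  splitSum (λ i j → suc j * g i j) k + splitSum (λ i j → suc i * g j i) k
    ≡⟨ splitSum-∙ (λ i j → suc j * g i j) (λ i j → suc i * g j i) k ⟨
  splitSum (λ i j → suc j * g i j + suc i * g j i) k
    ≡⟨ splitSum-cong k (λ i j i+j → begin
         suc j * g i j + suc i * g j i  ≡⟨ cong (λ x → suc j * g i j + suc i * x) (g-sym j i) ⟩
         suc j * g i j + suc i * g i j  ≡⟨ ℕₚ.*-distribʳ-+ (g i j) (suc j) (suc i) ⟨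
         (suc j + suc i) * g i j
           ≡⟨ cong (_* g i j) (trans (ℕₚ.+-comm (suc j) (suc i)) (trans (ℕₚ.+-suc (suc i) j) (cong suc i+j))) ⟩
         suc k * g i j                  ∎) ⟩
  splitSum (λ i j → suc k * g i j) k
    ≡⟨ splitSum-hom (suc k *_) (ℕₚ.*-zeroʳ (suc k)) (ℕₚ.*-distribˡ-+ (suc k)) g k ⟩
  suc k * splitSum g k ∎

module _ {W : List Letter} (det : Deterministic W) {k : ℕ} {L : List ℕ}
         (sorted : Sorted L) (len : length L ≡ 2 + k) where
  open Count det

  -- The head of the list is the rightmost column of the puzzle, the only one whose orientation is
  -- free.
  Starts : Bool → List Column → Set
  Starts o = Splits L λ l lo L′ → Splits L′ λ m hi r cs → ∃ λ cs′ →
    cs ≡ orient o lo hi ∷ cs′ × Completes o l lo m hi r cs′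

  Starts⇒Chain : ∀ o {cs} → Starts o cs → Chain cs × flatten cs ↭ L
  Starts⇒Chain o (l , lo , _ , refl , m , hi , r , refl , cs , refl , chain , perm) =
    chain , ↭-trans (flatten-orient o lo hi cs)
      (↭-trans (prep lo (prep hi perm)) (↭-sym (extract₂ l m r)))

  orient⇒Starts : ∀ o {lo hi cs} → lo < hi → Chain (orient o lo hi ∷ cs) →
                  flatten (orient o lo hi ∷ cs) ↭ L → Starts o (orient o lo hi ∷ cs)
  orient⇒Starts o {lo} {hi} {cs} lo<hi chain perm
    with perm′ ← ↭-trans (↭-sym (flatten-orient o lo hi cs)) perm
    with l , L′ , refl ← ∈-∃++ (∈-resp-↭ perm′ (here refl))
    with m , r , refl ← ∈-∃++ {xs = L′}
      -- The points of `l` precede `lo`, so the larger label `hi` lies in `L′`.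
      ([ (λ hi∈l → ⊥-elim (ℕₚ.<-asym lo<hi (All.lookup (AllPairs-before l sorted) hi∈l)))
       , (λ { (here refl) → ⊥-elim (ℕₚ.<-irrefl refl lo<hi) ; (there hi∈L′) → hi∈L′ }) ]′
       (∈-++⁻ l (∈-resp-↭ perm′ (there (here refl))))) =
    l , lo , m ++ hi ∷ r , refl , m , hi , r , refl , cs , refl , chain ,
    drop-∷ (drop-∷ (↭-trans perm′ (extract₂ l m r)))

  ¬repeated-label : ∀ {a xs} → ¬ (a ∷ a ∷ xs ↭ L)
  ¬repeated-label {a} perm with ∈-∃++ (∈-resp-↭ perm (here refl))
  ... | l₁ , l₂ , refl with ∈-++⁻ l₁ (∈-resp-↭ (drop-∷ (↭-trans perm (shift a l₁ l₂))) (here refl))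
  ... | inj₁ a∈l₁ = ℕₚ.<-irrefl refl (All.lookup (AllPairs-before l₁ sorted) a∈l₁)
  ... | inj₂ a∈l₂ = ℕₚ.<-irrefl refl (All.lookup (AllPairs-after l₁ sorted) a∈l₂)

  Chain⇒Starts : ∀ {cs} → Chain cs × flatten cs ↭ L → Starts true cs ⊎ Starts false cs
  Chain⇒Starts {[]} (_ , perm) with () ← trans (↭-length perm) len
  Chain⇒Starts {(a , b) ∷ cs} (chain , perm) with ℕₚ.<-cmp a b
  ... | tri< a<b _ _  = inj₂ (orient⇒Starts false a<b chain perm)
  ... | tri> _ _ b<a  = inj₁ (orient⇒Starts true b<a chain perm)
  ... | tri≈ _ refl _ = ⊥-elim (¬repeated-label perm)

  start-bounds : ∀ {l lo L′ m hi r} → L ≡ l ++ lo ∷ L′ → L′ ≡ m ++ hi ∷ r → lo < hi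
  start-bounds {l} {m = m} refl refl = Bounds.lo<hi {l} {m} sorted

  HasCard-Starts : ∀ o → HasCard (Starts o) (splitSum (λ i i′ → splitSum (λ j j′ → chains k j (i + j′)) i′) (2 + k))
  HasCard-Starts o = subst
    (λ n → HasCard (Starts o) (splitSum (λ i i′ → splitSum (λ j j′ → chains k j (i + j′)) i′) n))
    len
    (HasCard-Splits L _ (Sorted⇒Unique sorted)
      (λ l lo L′ L≡ → HasCard-Splits L′ (λ j j′ → chains k j (length l + j′))
        (AllPairs.tail (AllPairs-++⁻ʳ l (subst Unique L≡ (Sorted⇒Unique sorted))))
        (λ m hi r L′≡ →
          let L≡′ = trans L≡ (cong (λ xs → l ++ lo ∷ xs) L′≡) in
          HasCard-map (orient o lo hi ∷_) Listₚ.∷-injectiveʳ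
            (HasCard-Completes k o (subst Sorted L≡′ sorted)
              (ℕₚ.suc-injective (ℕₚ.suc-injective
                (trans (sym (↭-length (extract₂ l m r))) (trans (cong length (sym L≡′)) len))))))
        (λ { L′≡ L′≡′ (_ , refl , _) (_ , eq , _) →
          proj₂ (proj₂ (orient-injective {o} {o} (start-bounds L≡ L′≡) (start-bounds L≡ L′≡′) (Listₚ.∷-injectiveˡ eq))) }))
      (λ { L≡ L≡′ (_ , _ , _ , L′≡ , _ , refl , _) (_ , _ , _ , L′≡′ , _ , eq , _) →
        proj₁ (proj₂ (orient-injective {o} {o} (start-bounds L≡ L′≡) (start-bounds L≡′ L′≡′) (Listₚ.∷-injectiveˡ eq))) }))

  HasCard-Chain : HasCard (λ cs → Chain cs × flatten cs ↭ L) ((2 + k) * splitSum (chains k) (suc k))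
  HasCard-Chain = subst (HasCard _)
    (trans (cong₂ _+_ (splitSum-rotate (chains k) (suc k)) (splitSum-rotate (chains k) (suc k)))
           (splitSum-average (chains k) (suc k) (chains-sym k)))
    (HasCard-cong [ Starts⇒Chain true , Starts⇒Chain false ]′ Chain⇒Starts
      (HasCard-⊎
        (λ { (_ , _ , _ , L≡ , _ , _ , _ , L′≡ , _ , refl , _) (_ , _ , _ , L≡′ , _ , _ , _ , L′≡′ , _ , eq , _) →
          true≢false (proj₁ (orient-injective {true} {false} (start-bounds L≡ L′≡)
             (start-bounds L≡′ L′≡′) (Listₚ.∷-injectiveˡ eq))) })
        (HasCard-Starts true) (HasCard-Starts false)))
    where
    true≢false : ¬ (true ≡ false)
    true≢false ()

-- Arrays as lists of columns.

columns : ∀ {n} → Array n → List Column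
columns (as , bs) = reverse (toList (zip as bs))

zip-injective : ∀ {n} (as as′ bs bs′ : Vec ℕ n) →
                toList (zip as bs) ≡ toList (zip as′ bs′) → (as , bs) ≡ (as′ , bs′)
zip-injective []       []         []       []         _  = refl
zip-injective (a ∷ as) (a′ ∷ as′) (b ∷ bs) (b′ ∷ bs′) eq
  with refl ← Listₚ.∷-injectiveˡ eq | refl ← zip-injective as as′ bs bs′ (Listₚ.∷-injectiveʳ eq) = refl

columns-injective : ∀ {n} {p q : Array n} → columns p ≡ columns q → p ≡ q
columns-injective {p = as , bs} {as′ , bs′} eq = zip-injective as as′ bs bs′ (Listₚ.reverse-injective eq)

zip-surjective : ∀ {n} cs → length cs ≡ n → ∃ λ ((as , bs) : Array n) → toList (zip as bs) ≡ cs
zip-surjective []             refl = ([] , []) , refl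
zip-surjective ((a , b) ∷ cs) refl with zip-surjective cs refl
... | (as , bs) , eq = (a ∷ as , b ∷ bs) , cong ((a , b) ∷_) eq

columns-surjective : ∀ {n} cs → length cs ≡ n → ∃ λ (p : Array n) → columns p ≡ cs
columns-surjective cs len with zip-surjective (reverse cs) (trans (Listₚ.length-reverse cs) len)
... | p , eq = p , trans (cong reverse eq) (Listₚ.reverse-involutive cs)

length-flatten : ∀ cs → length (flatten cs) ≡ 2 * length cs
length-flatten []             = refl
length-flatten ((a , b) ∷ cs) = trans (cong (2 +_) (length-flatten cs)) (sym (ℕₚ.*-suc 2 (length cs)))

flatten-↭ : ∀ {cs cs′} → cs ↭ cs′ → flatten cs ↭ flatten cs′
flatten-↭ Perm.refl = ↭-refl
flatten-↭ (prep (a , b) p) = prep a (prep b (flatten-↭ p))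
flatten-↭ (Perm.swap (a , b) (c , d) p) = ↭-trans (shifts (a ∷ b ∷ []) (c ∷ d ∷ []))
  (prep c (prep d (prep a (prep b (flatten-↭ p)))))
flatten-↭ (Perm.trans p q) = ↭-trans (flatten-↭ p) (flatten-↭ q)

flatten-zip : ∀ {n} (as bs : Vec ℕ n) → flatten (toList (zip as bs)) ↭ toList as ++ toList bs
flatten-zip []       []       = ↭-refl
flatten-zip (a ∷ as) (b ∷ bs) = prep a (↭-trans (prep b (flatten-zip as bs)) (↭-sym (shift b (toList as) (toList bs))))

flatten-columns : ∀ {n} (p : Array n) → flatten (columns p) ↭ toList (proj₁ p) ++ toList (proj₂ p)
flatten-columns (as , bs) = ↭-trans (flatten-↭ (↭-reverse (toList (zip as bs)))) (flatten-zip as bs)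

module _ {A : Set} {R : A → A → Set} where
  Linked-ʳ++ : ∀ {x xs ys} → Linked R (x ∷ xs) → Linked (flip R) (x ∷ ys) → Linked (flip R) (xs ʳ++ x ∷ ys)
  Linked-ʳ++ [-]       ys = ys
  Linked-ʳ++ (Rx ∷ xs) ys = Linked-ʳ++ xs (Rx ∷ ys)

  Linked-reverse : ∀ {xs} → Linked R xs → Linked (flip R) (reverse xs)
  Linked-reverse {[]}     []  = []
  Linked-reverse {x ∷ xs} Rxs = Linked-ʳ++ Rxs [-]

All-pieces⇒Linked : ∀ {n W} (as bs : Vec ℕ n) →
  All (λ p → Any (λ l → reduce p ≡ std l) W) (pieces as bs) → Linked (Ok W) (toList (zip as bs))
All-pieces⇒Linked []            []            _          = []
All-pieces⇒Linked (a ∷ [])      (b ∷ [])      _          = [-]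
All-pieces⇒Linked (a ∷ a′ ∷ as) (b ∷ b′ ∷ bs) (ok ∷ oks) = ok ∷ All-pieces⇒Linked (a′ ∷ as) (b′ ∷ bs) oks

Linked⇒All-pieces : ∀ {n W} (as bs : Vec ℕ n) →
  Linked (Ok W) (toList (zip as bs)) → All (λ p → Any (λ l → reduce p ≡ std l) W) (pieces as bs)
Linked⇒All-pieces []            []            _          = []
Linked⇒All-pieces (a ∷ [])      (b ∷ [])      _          = []
Linked⇒All-pieces (a ∷ a′ ∷ as) (b ∷ b′ ∷ bs) (ok ∷ oks) = ok ∷ Linked⇒All-pieces (a′ ∷ as) (b′ ∷ bs) oks

-- Here `k` is the number of labels left after the rightmost column, so `2 + k` is twice the width.
HasCard-InW : ∀ {W} → Deterministic W → ∀ m → let k = 2 * suc m in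
  HasCard (InW W (2 + m)) ((2 + k) * splitSum (chains k) (suc k))
HasCard-InW {W} det m = HasCard-cong from to (HasCard-comap columns columns-injective surjective
  (HasCard-Chain det
    (AllPairsₚ.map⁺ (AllPairsₚ.applyUpTo⁺₁ id (2 * n) (λ i<j _ → s≤s i<j)))
    (trans length-labels (ℕₚ.*-suc 2 (suc m)))))
  where
  open Count det using (Chain)
  n = 2 + m
  labels = map suc (upTo (2 * n))
  length-labels : length labels ≡ 2 * n
  length-labels = trans (Listₚ.length-map suc (upTo (2 * n))) (Listₚ.length-upTo (2 * n))
  surjective : ∀ {cs} → Chain cs × flatten cs ↭ labels → ∃ λ (p : Array n) → columns p ≡ cs
  surjective {cs} (_ , perm) = columns-surjective cs (ℕₚ.*-cancelˡ-≡ _ _ 2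
    (trans (sym (length-flatten cs)) (trans (↭-length perm) length-labels)))
  from : ∀ {p} → Chain (columns p) × flatten (columns p) ↭ labels → InW W n p
  from {as , bs} (chain , perm) =
    ↭-trans (↭-sym (flatten-columns (as , bs))) perm ,
    Linked⇒All-pieces as bs (subst (Linked (Ok W)) (Listₚ.reverse-involutive _) (Linked-reverse chain))
  to : ∀ {p} → InW W n p → Chain (columns p) × flatten (columns p) ↭ labels
  to {as , bs} (perm , ok) =
    Linked-reverse (All-pieces⇒Linked as bs ok) , ↭-trans (flatten-columns (as , bs)) perm

-- Comparison with the tangent numbers.

weight-2* : ∀ m → weight (2 * m) ≡ 2 ^ m
weight-2* zero    = refl
weight-2* (suc m) = trans (cong weight (ℕₚ.*-suc 2 m))
  (cong₂ _+_ (weight-2* m) (trans (weight-2* m) (sym (ℕₚ.+-identityʳ (2 ^ m)))))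

tangent-count : ∀ m → let k = 2 * suc m in
  ℕ→ℚ ((2 + k) * splitSum (chains k) (suc k)) *ℚ ℕ→ℚ (2 ^ m) ≡ ℕ→ℚ (2 + m) *ℚ T (2 * (2 + m) ∸ 1)
tangent-count m = begin
  ℕ→ℚ ((2 + k) * t) *ℚ ℕ→ℚ (2 ^ m)
    ≡⟨ ℕ→ℚ-* ((2 + k) * t) (2 ^ m) ⟨
  ℕ→ℚ ((2 + k) * t * 2 ^ m)
    -- The factor `2 + k` is twice the width; its 2 joins `2 ^ m` to give the weight of `k`.
    ≡⟨ cong ℕ→ℚ (solve 3 (λ m t p → (con 2 :+ con 2 :* (con 1 :+ m)) :* t :* p := (con 2 :+ m) :* ((con 2 :* p) :* t))
         refl m t (2 ^ m)) ⟩
  ℕ→ℚ ((2 + m) * (2 ^ suc m * t))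
    ≡⟨ cong (λ w → ℕ→ℚ ((2 + m) * (w * t))) (weight-2* (suc m)) ⟨
  ℕ→ℚ ((2 + m) * (weight k * t))
    ≡⟨ trans (ℕ→ℚ-* (2 + m) (weight k * t)) (cong (ℕ→ℚ (2 + m) *ℚ_) (ℕ→ℚ-* (weight k) t)) ⟩
  ℕ→ℚ (2 + m) *ℚ chainTotal (suc k)
    ≡⟨ cong (ℕ→ℚ (2 + m) *ℚ_) (chainTotal≡tan (suc k)) ⟩
  ℕ→ℚ (2 + m) *ℚ T (suc k)
    ≡⟨ cong (λ j → ℕ→ℚ (2 + m) *ℚ T (j ∸ 1)) (ℕₚ.*-suc 2 (suc m)) ⟨
  ℕ→ℚ (2 + m) *ℚ T (2 * (2 + m) ∸ 1) ∎
  where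
  open +-*-Solver
  k = 2 * suc m
  t = splitSum (chains k) (suc k)

theorem3 : (n : ℕ) → 2 ≤ n → (W : List Letter) → W ∈ sixWords →
    Σ ℕ λ k → HasCard (InW W n) k ×
    (ℕ→ℚ k *ℚ ℕ→ℚ (2 ^ (n ∸ 2)) ≡ ℕ→ℚ n *ℚ T (2 * n ∸ 1))
theorem3 (suc (suc m)) _ W W∈ = _ , HasCard-InW (sixWords-deterministic W∈) m , tangent-count m
theorem3 (suc zero) (s≤s ()) _ _
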